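{- For every $n\ge2$, the triple of statistics $(\mathbf{F},\mathbf{spi},\mathbf{NL})$ on $\mathrm{And}_n^{I}$ and the triple $(\mathbf{pit},\mathbf{L},\mathbf{grn})$ on $\mathrm{And}_n^{II}$ are equidistributed: for all integers $p,q,r$, $\#\{w\in\mathrm{And}_n^{I}:(\mathbf{F}\,w,\mathbf{spi}\,w,\mathbf{NL}\,w)=(p,q,r)\}=\#\{w\in\mathrm{And}_n^{II}:(\mathbf{pit}\,w,\mathbf{L}\,w,\mathbf{grn}\,w)=(p,q,r)\}$.
   Context: Words $w=x_1\cdots x_n$ are permutations of finite sets $Y$ of positive integers. Andr\'e permutations: the empty word and one-letter words are Andr\'e I and II; for $|Y|\ge2$ write $w=v\,\min(w)\,v'$; $w$ is Andr\'e I (resp. II) if $v,v'$ are Andr\'e I (resp. II) and $\max(vv')$ (resp. $\min(vv')$) is a letter of $v'$. $\mathrm{And}_n^{I}$, $\mathrm{And}_n^{II}$: Andr\'e I, II permutations of $\{1,\dots,n\}$. Statistics for $w=x_1\cdots x_n$, $n\ge2$: $\mathbf{F}\,w=x_1$; $\mathbf{L}\,w=x_n$; $\mathbf{NL}\,w=x_{n-1}$; $\mathbf{grn}\,w=\max\{x_{i-1},x_{i+1}\}$ where $x_i$ is the maximum letter, with $x_0=x_{n+1}=0$; $\mathbf{spi}\,w$ (spike) is the letter $x_i$ ($1\le i\le n$) such that $x_1\le x_j$ for all $j\le i$ and $x_1>x_{i+1}$, with the convention $x_{n+1}=0$; $\mathbf{pit}\,w$ (pit) is defined for words with $x_{n-1}<x_n$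 recursively: if $w$ ends with its maximum letter, $\mathbf{pit}\,w=\min(w)$; otherwise write $w=w_1\,\min(w)\,w_2$ and set $\mathbf{pit}\,w=\mathbf{pit}\,w_2$ (a one-letter $w_2$ ends with its maximum). -}

module Defs where

open import Data.Nat using (ℕ; zero; suc; _⊔_; _⊓_; _≡ᵇ_; _<ᵇ_)
open import Data.Bool using (Bool; true; false; _∧_; if_then_else_)
open import Data.List using (List; []; _∷_; _++_; [_]; map; concatMap; foldr; length; upTo)
open import Data.Bool.ListAction using (any)
open import Data.Product using (_×_; _,_)

-- Words are lists of positive integers (letters), assumed to have distinct letters.

maxL : List ℕ → ℕ
maxL = foldr _⊔_ 0

-- minimum letter (0 for the empty word; only used on nonempty words)
minL : List ℕ → ℕ
minL [] = 0
minL (x ∷ xs) = foldr _⊓_ x xs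

memb : ℕ → List ℕ → Bool
memb m = any (λ y → y ≡ᵇ m)

splitOn : ℕ → List ℕ → List ℕ × List ℕ
splitOn m [] = [] , []
splitOn m (x ∷ xs) with x ≡ᵇ m
... | true = [] , xs
... | false with splitOn m xs
...   | (v , v') = (x ∷ v) , v'

-- André I / II, by recursion on w = v min(w) v'; the natural-number argument is
-- fuel (length w suffices since v and v' are strictly shorter than w).
andreIf : ℕ → List ℕ → Bool
andreIf _ [] = true
andreIf _ (x ∷ []) = true
andreIf zero (x ∷ y ∷ ys) = false
andreIf (suc k) w@(x ∷ y ∷ ys) with splitOn (minL w) w
... | (v , v') = andreIf k v ∧ andreIf k v' ∧ memb (maxL (v ++ v')) v'

andreIIf : ℕ → List ℕ → Bool
andreIIf _ [] = true
andreIIf _ (x ∷ []) = true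
andreIIf zero (x ∷ y ∷ ys) = false
andreIIf (suc k) w@(x ∷ y ∷ ys) with splitOn (minL w) w
... | (v , v') = andreIIf k v ∧ andreIIf k v' ∧ memb (minL (v ++ v')) v'

isAndreI : List ℕ → Bool
isAndreI w = andreIf (length w) w

isAndreII : List ℕ → Bool
isAndreII w = andreIIf (length w) w

insertions : ℕ → List ℕ → List (List ℕ)
insertions x [] = [ x ∷ [] ]
insertions x (y ∷ ys) = (x ∷ y ∷ ys) ∷ map (y ∷_) (insertions x ys)

perms : List ℕ → List (List ℕ)
perms [] = [ [] ]
perms (x ∷ xs) = concatMap (insertions x) (perms xs)

range1 : ℕ → List ℕ
range1 n = map suc (upTo n)

countB : {A : Set} → (A → Bool) → List A → ℕ
countB P [] = 0
countB P (x ∷ xs) = if P x then suc (countB P xs) else countB P xs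

-- Statistics (meaningful for words of length ≥ 2; default 0 otherwise)

F : List ℕ → ℕ
F [] = 0
F (x ∷ _) = x

L : List ℕ → ℕ
L [] = 0
L (x ∷ []) = x
L (x ∷ y ∷ ys) = L (y ∷ ys)

NL : List ℕ → ℕ
NL (x ∷ y ∷ []) = x
NL (x ∷ y ∷ z ∷ zs) = NL (y ∷ z ∷ zs)
NL _ = 0

-- grn: max of the two neighbours of the maximum letter, with x_0 = x_{n+1} = 0
grnAux : ℕ → ℕ → List ℕ → ℕ
grnAux M prev [] = 0
grnAux M prev (x ∷ xs) = if x ≡ᵇ M then prev ⊔ F xs else grnAux M x xs

grn : List ℕ → ℕ
grn w = grnAux (maxL w) 0 w

-- spike: the letter x_i, i ≥ 1 minimal with x_{i+1} < x_1 (convention x_{n+1} = 0);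
-- then automatically x_1 ≤ x_j for all j ≤ i.
spiAux : ℕ → ℕ → List ℕ → ℕ
spiAux x1 cur [] = cur
spiAux x1 cur (y ∷ ys) = if y <ᵇ x1 then cur else spiAux x1 y ys

spi : List ℕ → ℕ
spi [] = 0
spi (x ∷ xs) = spiAux x x xs

-- pit: if w ends with its maximum letter, min w; otherwise pit of the part of w
-- to the right of min w.  Natural-number argument is fuel (length w suffices).
pitf : ℕ → List ℕ → ℕ
pitf zero w = 0
pitf (suc k) w = if L w ≡ᵇ maxL w then minL w else pitf k (splitOnR w)
  where
  splitOnR : List ℕ → List ℕ
  splitOnR u with splitOn (minL u) u
  ... | (_ , v') = v'

pit : List ℕ → ℕ
pit w = pitf (length w) w

module Submission where

-- Fix weights h and ρ, and sum h (F w) (spi w) ρ (NL w) over type I and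
-- h (pit w) (L w) ρ (grn w) over type II.  In w = v x v′ with x the minimum letter, every
-- statistic is determined by v or by v′, and the remaining letters are distributed freely
-- over the two factors, except that for type I the largest letter z, for type II the
-- second smallest letter y, goes to v′.  With t counting André permutations, put
--   M x ∅ = ρ x,   M x (y ∷ V) = Σ t(U) M y V′   (over all splittings of V into U, V′).
-- Both weighted sums over x, S, z are of the form h x z · M x S + R x S: the first term
-- is the contribution of v = ∅ for type I, and of the words ending with z for type II.
-- Both remainders satisfy R x ∅ = 0 and
--   R x (y ∷ S) = Σ Â(y ∷ U) M x V + Σ t(U) R y V   (over all splittings of S into U, V),
-- where Â is the sum for ρ = 1; for type II this removes x, and for type I it follows
-- from R x S = Σ Â(U) M x V (U ≠ ∅) by expanding M x (y ∷ V).

open import Defs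
open import Data.Bool using (Bool; true; false; _∧_; not; if_then_else_)
open import Data.Bool.Properties using (∧-zeroʳ; ∧-identityʳ; T-≡; ¬-not)
open import Data.List using (List; []; _∷_; _++_; [_]; _∷ʳ_; map; concatMap; foldr; length; upTo; initLast; _∷ʳ′_)
open import Data.List.Membership.Propositional using (_∈_)
open import Data.List.Membership.Propositional.Properties using (∈-++⁺ˡ; ∈-++⁺ʳ; foldr-selective)
open import Data.List.Properties using (length-++; length-map; length-upTo)
open import Data.List.Relation.Binary.Permutation.Propositional using (_↭_; ↭-refl; ↭-sym; ↭-trans; prep; swap)
open import Data.List.Relation.Binary.Permutation.Propositional.Properties using (All-resp-↭; ∈-resp-↭; ↭-length)
open import Data.List.Relation.Binary.Sublist.Propositional using (_⊆_; []; _∷_; ⊆-refl) renaming (_∷ʳ_ to _∷ˢ_)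
open import Data.List.Relation.Binary.Sublist.Propositional.Properties using (All-resp-⊆; length-mono-≤; ++⁺)
open import Data.List.Relation.Unary.All as All using (All; []; _∷_)
open import Data.List.Relation.Unary.All.Properties as All using ()
open import Data.List.Relation.Unary.AllPairs as AllPairs using (AllPairs; []; _∷_)
open import Data.List.Relation.Unary.AllPairs.Properties as AllPairs using ()
open import Data.List.Relation.Unary.Any using (here; there)
open import Data.Nat using (ℕ; zero; suc; _+_; _*_; _≤_; _<_; _⊔_; _⊓_; _≡ᵇ_; _<ᵇ_; z≤n; s≤s)
open import Data.Nat.Properties
open import Data.Nat.ListAction using (sum)
open import Data.Nat.Tactic.RingSolver using (solve-∀)
open import Data.Product using (_×_; _,_; proj₁; proj₂)
open import Data.Sum using (inj₁; inj₂)
open import Function using (_∘_; const; Equivalence)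
open import Relation.Binary.PropositionalEquality
  using (_≡_; _≢_; refl; sym; trans; cong; cong₂; subst; module ≡-Reasoning)
open import Relation.Nullary using (yes; no)

open ≡-Reasoning

private
  variable
    A B : Set

+-interchange : ∀ a b c d → (a + b) + (c + d) ≡ (a + c) + (b + d)
+-interchange = solve-∀

+-left-comm : ∀ a b c → a + (b + c) ≡ b + (a + c)
+-left-comm = solve-∀

*-left-comm : ∀ a b c → a * (b * c) ≡ b * (a * c)
*-left-comm = solve-∀

-- Sums over lists

Σ[_] : List A → (A → ℕ) → ℕ
Σ[ xs ] f = sum (map f xs)

Σ-cong-All : {P : A → Set} {f g : A → ℕ} {xs : List A} →
  All P xs → (∀ {x} → P x → f x ≡ g x) → Σ[ xs ] f ≡ Σ[ xs ] g
Σ-cong-All []         eq = refl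
Σ-cong-All (px ∷ pxs) eq = cong₂ _+_ (eq px) (Σ-cong-All pxs eq)

Σ-cong : {f g : A → ℕ} (xs : List A) → (∀ x → f x ≡ g x) → Σ[ xs ] f ≡ Σ[ xs ] g
Σ-cong []       eq = refl
Σ-cong (x ∷ xs) eq = cong₂ _+_ (eq x) (Σ-cong xs eq)

Σ-zero : (xs : List A) → Σ[ xs ] (const 0) ≡ 0
Σ-zero []       = refl
Σ-zero (x ∷ xs) = Σ-zero xs

Σ-+ : (f g : A → ℕ) (xs : List A) → Σ[ xs ] (λ x → f x + g x) ≡ Σ[ xs ] f + Σ[ xs ] g
Σ-+ f g []       = refl
Σ-+ f g (x ∷ xs) =
  trans (cong (f x + g x +_) (Σ-+ f g xs)) (+-interchange (f x) (g x) (Σ[ xs ] f) (Σ[ xs ] g))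

Σ-*ˡ : (c : ℕ) (f : A → ℕ) (xs : List A) → Σ[ xs ] (λ x → c * f x) ≡ c * Σ[ xs ] f
Σ-*ˡ c f []       = sym (*-zeroʳ c)
Σ-*ˡ c f (x ∷ xs) = trans (cong (c * f x +_) (Σ-*ˡ c f xs)) (sym (*-distribˡ-+ c (f x) (Σ[ xs ] f)))

Σ-++ : (f : A → ℕ) (xs ys : List A) → Σ[ xs ++ ys ] f ≡ Σ[ xs ] f + Σ[ ys ] f
Σ-++ f []       ys = refl
Σ-++ f (x ∷ xs) ys = trans (cong (f x +_) (Σ-++ f xs ys)) (sym (+-assoc (f x) (Σ[ xs ] f) (Σ[ ys ] f)))

Σ-map : (g : A → B) (f : B → ℕ) (xs : List A) → Σ[ map g xs ] f ≡ Σ[ xs ] (f ∘ g)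
Σ-map g f []       = refl
Σ-map g f (x ∷ xs) = cong (f (g x) +_) (Σ-map g f xs)

Σ-concatMap : (g : A → List B) (f : B → ℕ) (xs : List A) →
  Σ[ concatMap g xs ] f ≡ Σ[ xs ] (λ x → Σ[ g x ] f)
Σ-concatMap g f []       = refl
Σ-concatMap g f (x ∷ xs) =
  trans (Σ-++ f (g x) (concatMap g xs)) (cong (Σ[ g x ] f +_) (Σ-concatMap g f xs))

Σ-swap : (f : A → B → ℕ) (xs : List A) (ys : List B) →
  Σ[ xs ] (λ x → Σ[ ys ] (f x)) ≡ Σ[ ys ] (λ y → Σ[ xs ] (λ x → f x y))
Σ-swap f []       ys = sym (Σ-zero ys)
Σ-swap f (x ∷ xs) ys =
  trans (cong (Σ[ ys ] (f x) +_) (Σ-swap f xs ys)) (sym (Σ-+ (f x) (λ y → Σ[ xs ] (λ x → f x y)) ys))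

-- Sums over all ways of distributing the letters of a list into two sublists

Σsplit : (List ℕ → List ℕ → ℕ) → List ℕ → ℕ
Σsplit f []      = f [] []
Σsplit f (x ∷ S) = Σsplit (λ U V → f (x ∷ U) V) S + Σsplit (λ U V → f U (x ∷ V)) S

Σsplit-cong-⊆ : ∀ S {f g} → (∀ {U V} → U ⊆ S → V ⊆ S → f U V ≡ g U V) → Σsplit f S ≡ Σsplit g S
Σsplit-cong-⊆ []      eq = eq [] []
Σsplit-cong-⊆ (x ∷ S) eq =
  cong₂ _+_ (Σsplit-cong-⊆ S λ u v → eq (refl ∷ u) (x ∷ˢ v)) (Σsplit-cong-⊆ S λ u v → eq (x ∷ˢ u) (refl ∷ v))

Σsplit-cong : ∀ S {f g} → (∀ U V → f U V ≡ g U V) → Σsplit f S ≡ Σsplit g S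
Σsplit-cong S eq = Σsplit-cong-⊆ S (λ {U} {V} _ _ → eq U V)

Σsplit-zero : ∀ S → Σsplit (λ _ _ → 0) S ≡ 0
Σsplit-zero []      = refl
Σsplit-zero (x ∷ S) = cong₂ _+_ (Σsplit-zero S) (Σsplit-zero S)

Σsplit-+ : ∀ f g S → Σsplit (λ U V → f U V + g U V) S ≡ Σsplit f S + Σsplit g S
Σsplit-+ f g []      = refl
Σsplit-+ f g (x ∷ S) = begin
  Σsplit (λ U V → f (x ∷ U) V + g (x ∷ U) V) S + Σsplit (λ U V → f U (x ∷ V) + g U (x ∷ V)) S
    ≡⟨ cong₂ _+_ (Σsplit-+ _ _ S) (Σsplit-+ _ _ S) ⟩
  (Σsplit (λ U V → f (x ∷ U) V) S + Σsplit (λ U V → g (x ∷ U) V) S)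
    + (Σsplit (λ U V → f U (x ∷ V)) S + Σsplit (λ U V → g U (x ∷ V)) S)
    ≡⟨ +-interchange (Σsplit (λ U V → f (x ∷ U) V) S) _ _ _ ⟩
  Σsplit f (x ∷ S) + Σsplit g (x ∷ S) ∎

Σsplit-*ˡ : ∀ c f S → Σsplit (λ U V → c * f U V) S ≡ c * Σsplit f S
Σsplit-*ˡ c f []      = refl
Σsplit-*ˡ c f (x ∷ S) =
  trans (cong₂ _+_ (Σsplit-*ˡ c _ S) (Σsplit-*ˡ c _ S))
        (sym (*-distribˡ-+ c (Σsplit (λ U V → f (x ∷ U) V) S) _))

Σsplit-flip : ∀ f S → Σsplit f S ≡ Σsplit (λ U V → f V U) S
Σsplit-flip f []      = refl
Σsplit-flip f (x ∷ S) = begin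
  Σsplit (λ U V → f (x ∷ U) V) S + Σsplit (λ U V → f U (x ∷ V)) S
    ≡⟨ cong₂ _+_ (Σsplit-flip _ S) (Σsplit-flip _ S) ⟩
  Σsplit (λ U V → f (x ∷ V) U) S + Σsplit (λ U V → f V (x ∷ U)) S
    ≡⟨ +-comm (Σsplit (λ U V → f (x ∷ V) U) S) _ ⟩
  Σsplit (λ U V → f V U) (x ∷ S) ∎

-- `Σsplit` unfolds at the first letter. Type I prescribes the side of the largest letter, which
-- comes last in an increasing list, so the case distinction is also needed at that end.
Σsplit-∷ʳ : ∀ f S z → Σsplit f (S ∷ʳ z) ≡ Σsplit (λ U V → f (U ∷ʳ z) V) S + Σsplit (λ U V → f U (V ∷ʳ z)) S
Σsplit-∷ʳ f []      z = refl
Σsplit-∷ʳ f (x ∷ S) z = begin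
  Σsplit (λ U V → f (x ∷ U) V) (S ∷ʳ z) + Σsplit (λ U V → f U (x ∷ V)) (S ∷ʳ z)
    ≡⟨ cong₂ _+_ (Σsplit-∷ʳ _ S z) (Σsplit-∷ʳ _ S z) ⟩
  (Σsplit (λ U V → f (x ∷ U ∷ʳ z) V) S + Σsplit (λ U V → f (x ∷ U) (V ∷ʳ z)) S)
    + (Σsplit (λ U V → f (U ∷ʳ z) (x ∷ V)) S + Σsplit (λ U V → f U (x ∷ V ∷ʳ z)) S)
    ≡⟨ +-interchange (Σsplit (λ U V → f (x ∷ U ∷ʳ z) V) S) _ _ _ ⟩
  Σsplit (λ U V → f (U ∷ʳ z) V) (x ∷ S) + Σsplit (λ U V → f U (V ∷ʳ z)) (x ∷ S) ∎

-- Both sides run over all distributions of `S` into three parts; only the order in which the parts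
-- are taken out differs.
Σsplit-left-comm : ∀ (f : List ℕ → List ℕ → List ℕ → ℕ) S →
  Σsplit (λ U R → Σsplit (λ V X → f U V X) R) S ≡ Σsplit (λ V R → Σsplit (λ U X → f U V X) R) S
Σsplit-left-comm f []      = refl
Σsplit-left-comm f (x ∷ S) = begin
  Σsplit (λ U R → Σsplit (f (x ∷ U)) R) S
    + Σsplit (λ U R → Σsplit (λ V X → f U (x ∷ V) X) R + Σsplit (λ V X → f U V (x ∷ X)) R) S
    ≡⟨ cong₂ _+_ (Σsplit-left-comm (λ U V X → f (x ∷ U) V X) S) (trans (Σsplit-+ _ _ S)
         (cong₂ _+_ (Σsplit-left-comm (λ U V X → f U (x ∷ V) X) S)
                    (Σsplit-left-comm (λ U V X → f U V (x ∷ X)) S))) ⟩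
  Σsplit (λ V R → Σsplit (λ U X → f (x ∷ U) V X) R) S
    + (Σsplit (λ V R → Σsplit (λ U X → f U (x ∷ V) X) R) S + Σsplit (λ V R → Σsplit (λ U X → f U V (x ∷ X)) R) S)
    ≡⟨ +-left-comm (Σsplit (λ V R → Σsplit (λ U X → f (x ∷ U) V X) R) S)
                   (Σsplit (λ V R → Σsplit (λ U X → f U (x ∷ V) X) R) S) _ ⟩
  Σsplit (λ V R → Σsplit (λ U X → f U (x ∷ V) X) R) S
    + (Σsplit (λ V R → Σsplit (λ U X → f (x ∷ U) V X) R) S + Σsplit (λ V R → Σsplit (λ U X → f U V (x ∷ X)) R) S)
    ≡⟨ cong (Σsplit (λ V R → Σsplit (λ U X → f U (x ∷ V) X) R) S +_) (sym (Σsplit-+ _ _ S)) ⟩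
  Σsplit (λ V R → Σsplit (λ U X → f U V X) R) (x ∷ S) ∎

-- Sums over permutations

Σcut : (List ℕ → List ℕ → ℕ) → List ℕ → ℕ
Σcut g []       = g [] []
Σcut g (y ∷ ys) = g [] (y ∷ ys) + Σcut (λ a b → g (y ∷ a) b) ys

Σcut-cong : ∀ {f g} w → (∀ a b → f a b ≡ g a b) → Σcut f w ≡ Σcut g w
Σcut-cong []       eq = eq [] []
Σcut-cong (y ∷ ys) eq = cong₂ _+_ (eq [] (y ∷ ys)) (Σcut-cong ys (λ a b → eq (y ∷ a) b))

Σcut-+ : ∀ f g w → Σcut (λ a b → f a b + g a b) w ≡ Σcut f w + Σcut g w
Σcut-+ f g []       = refl
Σcut-+ f g (y ∷ ys) =
  trans (cong (f [] (y ∷ ys) + g [] (y ∷ ys) +_) (Σcut-+ _ _ ys)) (+-interchange (f [] (y ∷ ys)) _ _ _)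

Σ-insertions : ∀ x (h : List ℕ → ℕ) w → Σ[ insertions x w ] h ≡ Σcut (λ a b → h (a ++ x ∷ b)) w
Σ-insertions x h []       = +-identityʳ (h [ x ])
Σ-insertions x h (y ∷ ys) =
  cong (h (x ∷ y ∷ ys) +_)
    (trans (Σ-map (y ∷_) h (insertions x ys)) (Σ-insertions x (h ∘ (y ∷_)) ys))

-- Deleting `y` from a cut word leaves a cut of `w`, together with the side of the cut on which `y`
-- stood.
Σ-insertions-cut : ∀ y g w → Σ[ insertions y w ] (Σcut g) ≡
  Σcut (λ a b → Σ[ insertions y a ] (λ a′ → g a′ b) + Σ[ insertions y b ] (g a)) w
Σ-insertions-cut y g []       = lemma (g [] [ y ]) (g [ y ] [])
  where
  lemma : ∀ p q → p + q + 0 ≡ q + 0 + (p + 0)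
  lemma = solve-∀
Σ-insertions-cut y g (x ∷ xs) = begin
  Σcut g (y ∷ x ∷ xs) + Σ[ map (x ∷_) (insertions y xs) ] (Σcut g)
    ≡⟨ cong (Σcut g (y ∷ x ∷ xs) +_) (trans (Σ-map (x ∷_) (Σcut g) (insertions y xs))
         (trans (Σ-+ (λ u → g [] (x ∷ u)) (Σcut gₓ) (insertions y xs))
                (cong (Σ[ insertions y xs ] (λ u → g [] (x ∷ u)) +_) (Σ-insertions-cut y gₓ xs)))) ⟩
  (p + (q + C)) + (I + Σcut (λ a b → Σ[ insertions y a ] (λ a′ → gₓ a′ b) + R a b) xs)
    ≡⟨ cong (λ n → (p + (q + C)) + (I + n)) (Σcut-+ (λ a b → Σ[ insertions y a ] (λ a′ → gₓ a′ b)) R xs) ⟩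
  (p + (q + C)) + (I + (D + E))
    ≡⟨ lemma p q C I D E ⟩
  (q + 0) + (p + I) + ((C + D) + E)
    ≡⟨ cong₂ (λ m n → (q + 0) + (p + m) + n) (sym (Σ-map (x ∷_) (g []) (insertions y xs)))
         (sym (trans (Σcut-cong xs (λ a b → cong (_+ R a b)
                  (cong (g (y ∷ x ∷ a) b +_) (Σ-map (x ∷_) (λ a′ → g a′ b) (insertions y a)))))
                (trans (Σcut-+ _ R xs) (cong (_+ E) (Σcut-+ (λ a b → g (y ∷ x ∷ a) b) _ xs))))) ⟩
  Σcut (λ a b → Σ[ insertions y a ] (λ a′ → g a′ b) + Σ[ insertions y b ] (g a)) (x ∷ xs) ∎
  where
  gₓ = λ a b → g (x ∷ a) b
  R = λ a b → Σ[ insertions y b ] (gₓ a)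
  p = g [] (y ∷ x ∷ xs)
  q = g [ y ] (x ∷ xs)
  C = Σcut (λ a b → g (y ∷ x ∷ a) b) xs
  I = Σ[ insertions y xs ] (λ u → g [] (x ∷ u))
  D = Σcut (λ a b → Σ[ insertions y a ] (λ a′ → gₓ a′ b)) xs
  E = Σcut R xs
  lemma : ∀ p q C I D E → (p + (q + C)) + (I + (D + E)) ≡ (q + 0) + (p + I) + ((C + D) + E)
  lemma = solve-∀

Σ-perms-∷ : ∀ y (h : List ℕ → ℕ) S → Σ[ perms (y ∷ S) ] h ≡ Σ[ perms S ] (λ w → Σ[ insertions y w ] h)
Σ-perms-∷ y h S = Σ-concatMap (insertions y) h (perms S)

-- A cut permutation of `S` amounts to a distribution of the letters over two pieces and a
-- permutation of each; in the induction `y` enters on either side of the cut.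
Σ-perms-cut : ∀ g S → Σ[ perms S ] (Σcut g) ≡ Σsplit (λ U V → Σ[ perms U ] (λ a → Σ[ perms V ] (g a))) S
Σ-perms-cut g []      = sym (+-identityʳ (g [] [] + 0))
Σ-perms-cut g (y ∷ S) = begin
  Σ[ perms (y ∷ S) ] (Σcut g)
    ≡⟨ Σ-perms-∷ y (Σcut g) S ⟩
  Σ[ perms S ] (λ w → Σ[ insertions y w ] (Σcut g))
    ≡⟨ Σ-cong (perms S) (λ w → trans (Σ-insertions-cut y g w) (Σcut-+ gˡ gʳ w)) ⟩
  Σ[ perms S ] (λ w → Σcut gˡ w + Σcut gʳ w)
    ≡⟨ Σ-+ (Σcut gˡ) (Σcut gʳ) (perms S) ⟩
  Σ[ perms S ] (Σcut gˡ) + Σ[ perms S ] (Σcut gʳ)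
    ≡⟨ cong₂ _+_ (Σ-perms-cut gˡ S) (Σ-perms-cut gʳ S) ⟩
  Σsplit (λ U V → Σ[ perms U ] (λ a → Σ[ perms V ] (gˡ a))) S
    + Σsplit (λ U V → Σ[ perms U ] (λ a → Σ[ perms V ] (gʳ a))) S
    ≡⟨ cong₂ _+_
         (Σsplit-cong S λ U V → trans
           (Σ-cong (perms U) λ a → Σ-swap (λ b a′ → g a′ b) (perms V) (insertions y a))
           (sym (Σ-perms-∷ y (λ a → Σ[ perms V ] (g a)) U)))
         (Σsplit-cong S λ U V → Σ-cong (perms U) λ a → sym (Σ-perms-∷ y (g a) V)) ⟩
  Σsplit (λ U V → Σ[ perms U ] (λ a → Σ[ perms V ] (g a))) (y ∷ S) ∎
  where
  gˡ gʳ : List ℕ → List ℕ → ℕ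
  gˡ a b = Σ[ insertions y a ] (λ a′ → g a′ b)
  gʳ a b = Σ[ insertions y b ] (g a)

Σ-perms-block : ∀ x (h : List ℕ → ℕ) S → Σ[ perms (x ∷ S) ] h ≡
  Σsplit (λ U V → Σ[ perms U ] (λ v → Σ[ perms V ] (λ v′ → h (v ++ x ∷ v′)))) S
Σ-perms-block x h S = trans (Σ-perms-∷ x h S)
  (trans (Σ-cong (perms S) (Σ-insertions x h)) (Σ-perms-cut (λ a b → h (a ++ x ∷ b)) S))

insertions-↭ : ∀ x w → All (_↭ x ∷ w) (insertions x w)
insertions-↭ x []       = ↭-refl ∷ []
insertions-↭ x (y ∷ ys) =
  ↭-refl ∷ All.map⁺ (All.map (λ r → ↭-trans (prep y r) (swap y x ↭-refl)) (insertions-↭ x ys))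

perms-↭ : ∀ S → All (_↭ S) (perms S)
perms-↭ []      = ↭-refl ∷ []
perms-↭ (x ∷ S) = All.concat⁺ (All.map⁺
  (All.map (λ {w} p → All.map (λ r → ↭-trans r (prep x p)) (insertions-↭ x w)) (perms-↭ S)))

-- Words with a given minimum letter

⟦_⟧ : Bool → ℕ
⟦ true ⟧  = 1
⟦ false ⟧ = 0

⟦⟧-∧ : ∀ a b → ⟦ a ∧ b ⟧ ≡ ⟦ a ⟧ * ⟦ b ⟧
⟦⟧-∧ true  b = sym (+-identityʳ ⟦ b ⟧)
⟦⟧-∧ false b = refl

≡ᵇ-refl : ∀ m → (m ≡ᵇ m) ≡ true
≡ᵇ-refl zero    = refl
≡ᵇ-refl (suc m) = ≡ᵇ-refl m

≡ᵇ-≢ : ∀ {m n} → m ≢ n → (m ≡ᵇ n) ≡ false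
≡ᵇ-≢ {m} {n} m≢n = ¬-not (λ e → m≢n (≡ᵇ⇒≡ m n (Equivalence.from T-≡ e)))

<ᵇ-true : ∀ {m n} → m < n → (m <ᵇ n) ≡ true
<ᵇ-true m<n = Equivalence.to T-≡ (<⇒<ᵇ m<n)

<ᵇ-false : ∀ {m n} → n < m → (m <ᵇ n) ≡ false
<ᵇ-false {m} {n} n<m = ¬-not (λ e → <-asym n<m (<ᵇ⇒< m n (Equivalence.from T-≡ e)))

memb-∈ : ∀ {z w} → z ∈ w → memb z w ≡ true
memb-∈ {z} (here refl) rewrite ≡ᵇ-refl z = refl
memb-∈ {z} {y ∷ _} (there z∈w) with y ≡ᵇ z
... | true  = refl
... | false = memb-∈ z∈w

memb-∉ : ∀ {z w} → All (_≢ z) w → memb z w ≡ false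
memb-∉ []            = refl
memb-∉ (y≢z ∷ w≢z) rewrite ≡ᵇ-≢ y≢z = memb-∉ w≢z

minL-∈ : ∀ x w → minL (x ∷ w) ∈ x ∷ w
minL-∈ x w with foldr-selective ⊓-sel x w
... | inj₁ e = here e
... | inj₂ i = there i

foldr-⊓-≤ : ∀ e w → All (foldr _⊓_ e w ≤_) (e ∷ w)
foldr-⊓-≤ e []      = ≤-refl ∷ []
foldr-⊓-≤ e (y ∷ w) with foldr-⊓-≤ e w
... | p ∷ ps = ≤-trans (m⊓n≤n y _) p ∷ m⊓n≤m y _ ∷ All.map (≤-trans (m⊓n≤n y _)) ps

minL-≡ : ∀ {m w} → m ∈ w → All (m ≤_) w → minL w ≡ m
minL-≡ {w = x ∷ w} m∈w m≤w = ≤-antisym (All.lookup (foldr-⊓-≤ x w) m∈w) (All.lookup m≤w (minL-∈ x w))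

maxL-≤ : ∀ {m w} → All (_≤ m) w → maxL w ≤ m
maxL-≤ []         = z≤n
maxL-≤ (p ∷ ps) = ⊔-lub p (maxL-≤ ps)

maxL-≥ : ∀ {m w} → m ∈ w → m ≤ maxL w
maxL-≥ (here refl) = m≤m⊔n _ _
maxL-≥ (there i)   = m≤n⇒m≤o⊔n _ (maxL-≥ i)

maxL-≡ : ∀ {m w} → m ∈ w → All (_≤ m) w → maxL w ≡ m
maxL-≡ m∈w w≤m = ≤-antisym (maxL-≤ w≤m) (maxL-≥ m∈w)

-- Splitting at the minimum letter and the André conditions

splitOn-++ : ∀ {x v} v′ → All (x <_) v → splitOn x (v ++ x ∷ v′) ≡ (v , v′)
splitOn-++ {x} v′ [] rewrite ≡ᵇ-refl x = refl
splitOn-++ {x} {a ∷ v} v′ (x<a ∷ x<v) rewrite ≡ᵇ-≢ {a} {x} (>⇒≢ x<a) | splitOn-++ v′ x<v = refl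

splitOn-length : ∀ {m w} → m ∈ w →
  length (proj₁ (splitOn m w)) < length w × length (proj₂ (splitOn m w)) < length w
splitOn-length {m} {x ∷ w} m∈ with x ≡ᵇ m in eq
... | true = s≤s z≤n , ≤-refl
splitOn-length {m} {x ∷ w} (here refl) | false with trans (sym eq) (≡ᵇ-refl m)
... | ()
splitOn-length {m} {x ∷ w} (there m∈) | false with splitOn m w | splitOn-length m∈
... | _ , _ | p , q = s≤s p , m<n⇒m<1+n q

minL-block : ∀ {x v v′} → All (x <_) v → All (x <_) v′ → minL (v ++ x ∷ v′) ≡ x
minL-block {v = v} x<v x<v′ = minL-≡ (∈-++⁺ʳ v (here refl)) (All.++⁺ (All.map <⇒≤ x<v) (≤-refl ∷ All.map <⇒≤ x<v′))

splitOn-block : ∀ {x v v′} → All (x <_) v → All (x <_) v′ →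
  splitOn (minL (v ++ x ∷ v′)) (v ++ x ∷ v′) ≡ (v , v′)
splitOn-block {v′ = v′} x<v x<v′ rewrite minL-block x<v x<v′ = splitOn-++ v′ x<v

-- The recursion shared by both types, with `maxL` or `minL` for `c`. Projections replace the `with`
-- of the definitions, so that the equation can be used for rewriting.
AndreStep : (List ℕ → ℕ) → (ℕ → List ℕ → Bool) → ℕ → List ℕ → Set
AndreStep c P k w = P (suc k) w ≡
  P k v ∧ P k v′ ∧ memb (c (v ++ v′)) v′
  where
  v v′ : List ℕ
  v  = proj₁ (splitOn (minL w) w)
  v′ = proj₂ (splitOn (minL w) w)

module Andre
  (c : List ℕ → ℕ) (P : ℕ → List ℕ → Bool)
  (P-[] : ∀ k → P k [] ≡ true) (P-[x] : ∀ k x → P k [ x ] ≡ true)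
  (P-step : ∀ k x y ys → AndreStep c P k (x ∷ y ∷ ys))
  where

  -- Both factors are strictly shorter than the word, so fuel of at least its length never runs out.
  fuel-irrelevant : ∀ k l w → length w ≤ k → length w ≤ l → P k w ≡ P l w
  fuel-irrelevant k l []       _ _ = trans (P-[] k) (sym (P-[] l))
  fuel-irrelevant k l (x ∷ []) _ _ = trans (P-[x] k x) (sym (P-[x] l x))
  fuel-irrelevant (suc k) (suc l) w@(x ∷ y ∷ ys) (s≤s p) (s≤s q)
    rewrite P-step k x y ys | P-step l x y ys
    with splitOn (minL w) w | splitOn-length (minL-∈ x (y ∷ ys))
  ... | v , v′ | s≤s i , s≤s j =
    cong₂ _∧_ (fuel-irrelevant k l v (≤-trans i p) (≤-trans i q))
      (cong (_∧ memb (c (v ++ v′)) v′) (fuel-irrelevant k l v′ (≤-trans j p) (≤-trans j q)))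

  -- The membership hypothesis excludes the one-letter word. The recursive clause matches on two
  -- leading letters, hence the cases of `v` empty, of one letter, or longer; the fuel of each
  -- factor is then lowered to its length.
  P-block : ∀ {x v v′} → All (x <_) v → All (x <_) v′ → ∀ {z} → z ∈ v ++ v′ →
    P (length (v ++ x ∷ v′)) (v ++ x ∷ v′) ≡
      P (length v) v ∧ P (length v′) v′ ∧ memb (c (v ++ v′)) v′
  P-block {x} {[]} {y ∷ v′} x<v x<v′ _
    rewrite P-step (suc (length v′)) x y v′ | splitOn-block {x} {[]} {y ∷ v′} x<v x<v′ =
    cong (_∧ (P _ (y ∷ v′) ∧ _)) (trans (P-[] _) (sym (P-[] 0)))
  P-block {x} {a ∷ []} {v′} x<v x<v′ _
    rewrite P-step (suc (length v′)) a x v′ | splitOn-block x<v x<v′ =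
    cong₂ _∧_ (trans (P-[x] _ a) (sym (P-[x] _ a)))
      (cong (_∧ _) (fuel-irrelevant _ _ v′ (n≤1+n _) ≤-refl))
  P-block {x} {v@(a ∷ b ∷ u)} {v′} x<v x<v′ _
    rewrite P-step (suc (length (u ++ x ∷ v′))) a b (u ++ x ∷ v′) | splitOn-block x<v x<v′ | length-++ u {x ∷ v′} =
    cong₂ _∧_ (fuel-irrelevant _ _ v (s≤s (subst (suc (length u) ≤_) (sym (+-suc _ _)) (s≤s (m≤m+n _ _)))) ≤-refl)
      (cong (_∧ _) (fuel-irrelevant _ _ v′ (m≤n⇒m≤1+n (≤-trans (n≤1+n _) (m≤n+m _ (length u)))) ≤-refl))

andreIf-[] : ∀ k → andreIf k [] ≡ true
andreIf-[] zero    = refl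
andreIf-[] (suc k) = refl

andreIf-[x] : ∀ k x → andreIf k [ x ] ≡ true
andreIf-[x] zero    x = refl
andreIf-[x] (suc k) x = refl

andreIf-step : ∀ k x y ys → AndreStep maxL andreIf k (x ∷ y ∷ ys)
andreIf-step k x y ys with splitOn (minL (x ∷ y ∷ ys)) (x ∷ y ∷ ys)
... | _ , _ = refl

andreIIf-[] : ∀ k → andreIIf k [] ≡ true
andreIIf-[] zero    = refl
andreIIf-[] (suc k) = refl

andreIIf-[x] : ∀ k x → andreIIf k [ x ] ≡ true
andreIIf-[x] zero    x = refl
andreIIf-[x] (suc k) x = refl

andreIIf-step : ∀ k x y ys → AndreStep minL andreIIf k (x ∷ y ∷ ys)
andreIIf-step k x y ys with splitOn (minL (x ∷ y ∷ ys)) (x ∷ y ∷ ys)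
... | _ , _ = refl

module AndreI  = Andre maxL andreIf andreIf-[] andreIf-[x] andreIf-step
module AndreII = Andre minL andreIIf andreIIf-[] andreIIf-[x] andreIIf-step

-- The maximum of the remaining letters is `z`, and it lies in `v′`, so the third condition holds.
andreI-keep : ∀ {x z v v′} → All (x <_) v → All (x <_) v′ → z ∈ v′ → All (_≤ z) (v ++ v′) →
  isAndreI (v ++ x ∷ v′) ≡ isAndreI v ∧ isAndreI v′
andreI-keep {v = v} {v′} x<v x<v′ z∈v′ ≤z
  rewrite AndreI.P-block x<v x<v′ (∈-++⁺ʳ v z∈v′) | maxL-≡ (∈-++⁺ʳ v z∈v′) ≤z | memb-∈ z∈v′ =
  cong (isAndreI v ∧_) (∧-identityʳ (isAndreI v′))

-- The maximum of the remaining letters is `z`, while every letter of `v′` is below it, so the third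
-- condition fails.
andreI-drop : ∀ {x z v v′} → All (x <_) v → All (x <_) v′ → z ∈ v → All (_≤ z) v → All (_< z) v′ →
  isAndreI (v ++ x ∷ v′) ≡ false
andreI-drop {v = v} {v′} x<v x<v′ z∈v v≤z v′<z
  rewrite AndreI.P-block x<v x<v′ (∈-++⁺ˡ {ys = v′} z∈v)
        | maxL-≡ (∈-++⁺ˡ {ys = v′} z∈v) (All.++⁺ v≤z (All.map <⇒≤ v′<z)) | memb-∉ (All.map <⇒≢ v′<z)
        | ∧-zeroʳ (isAndreI v′) = ∧-zeroʳ (isAndreI v)

andreII-keep : ∀ {x y v v′} → All (x <_) v → All (x <_) v′ → y ∈ v′ → All (y ≤_) (v ++ v′) →
  isAndreII (v ++ x ∷ v′) ≡ isAndreII v ∧ isAndreII v′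
andreII-keep {v = v} {v′} x<v x<v′ y∈v′ y≤
  rewrite AndreII.P-block x<v x<v′ (∈-++⁺ʳ v y∈v′) | minL-≡ (∈-++⁺ʳ v y∈v′) y≤ | memb-∈ y∈v′ =
  cong (isAndreII v ∧_) (∧-identityʳ (isAndreII v′))

andreII-drop : ∀ {x y v v′} → All (x <_) v → All (x <_) v′ → y ∈ v → All (y ≤_) v → All (y <_) v′ →
  isAndreII (v ++ x ∷ v′) ≡ false
andreII-drop {v = v} {v′} x<v x<v′ y∈v y≤v y<v′
  rewrite AndreII.P-block x<v x<v′ (∈-++⁺ˡ {ys = v′} y∈v)
        | minL-≡ (∈-++⁺ˡ {ys = v′} y∈v) (All.++⁺ y≤v (All.map <⇒≤ y<v′)) | memb-∉ (All.map >⇒≢ y<v′)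
        | ∧-zeroʳ (isAndreII v′) = ∧-zeroʳ (isAndreII v)

-- Statistics of v x v′, where x is the minimum letter

L-++ : ∀ v {z v′} → z ∈ v′ → L (v ++ v′) ≡ L v′
L-++ []          _           = refl
L-++ (a ∷ [])    (here _)    = refl
L-++ (a ∷ [])    (there _)   = refl
L-++ (a ∷ b ∷ v) z∈v′ = L-++ (b ∷ v) z∈v′

L-block : ∀ v {x z v′} → z ∈ v′ → L (v ++ x ∷ v′) ≡ L v′
L-block v {x} z∈v′ = trans (L-++ v (there z∈v′)) (L-++ [ x ] z∈v′)

L-∈ : ∀ {z w} → z ∈ w → L w ∈ w
L-∈ {w = a ∷ []}    _ = here refl
L-∈ {w = a ∷ b ∷ w} _ = there (L-∈ {w = b ∷ w} (here refl))

-- The letter `x` stays in front of `v′` because it is next to last when `v′` has one letter.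
NL-block : ∀ v {x z v′} → z ∈ v′ → NL (v ++ x ∷ v′) ≡ NL (x ∷ v′)
NL-block []          _ = refl
NL-block (a ∷ [])    (here _)  = refl
NL-block (a ∷ [])    (there _) = refl
NL-block (a ∷ b ∷ []) z∈v′ = NL-block (b ∷ []) z∈v′
NL-block (a ∷ b ∷ c ∷ v) z∈v′ = NL-block (b ∷ c ∷ v) z∈v′

-- The scan stops at `x`, which is below the first letter `a`, if not earlier; nothing after `x` is
-- seen.
spiAux-++ : ∀ {x a} c u {v′} → x < a → spiAux a c (u ++ x ∷ v′) ≡ spiAux a c u
spiAux-++ c []      x<a rewrite <ᵇ-true x<a = refl
spiAux-++ {a = a} c (y ∷ u) x<a with y <ᵇ a
... | true  = refl
... | false = spiAux-++ y u x<a

-- No letter falls below the minimum, so the scan reaches the end of the word.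
spi-min : ∀ {x} c {v} → All (x <_) v → spiAux x c v ≡ L (c ∷ v)
spi-min c []                  = refl
spi-min {x} c {y ∷ v} (x<y ∷ x<v) rewrite <ᵇ-false x<y = spi-min y x<v

pitf-suc : ∀ k w → pitf (suc k) w ≡ (if L w ≡ᵇ maxL w then minL w else pitf k (proj₂ (splitOn (minL w) w)))
pitf-suc k w with splitOn (minL w) w
... | _ , _ = refl

pitf-[] : ∀ k → pitf k [] ≡ 0
pitf-[] zero    = refl
pitf-[] (suc k) = refl

pitf-fuel : ∀ k l w → length w ≤ k → length w ≤ l → pitf k w ≡ pitf l w
pitf-fuel k l [] _ _ = trans (pitf-[] k) (sym (pitf-[] l))
pitf-fuel (suc k) (suc l) w@(x ∷ u) (s≤s p) (s≤s q)
  rewrite pitf-suc k w | pitf-suc l w with L w ≡ᵇ maxL w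
... | true  = refl
... | false with splitOn (minL w) w | splitOn-length (minL-∈ x u)
...   | _ , v′ | _ , s≤s j = pitf-fuel k l v′ (≤-trans j p) (≤-trans j q)

pit-max : ∀ {x z w} → x ∈ w → All (x ≤_) w → z ∈ w → All (_≤ z) w → L w ≡ z → pit w ≡ x
pit-max {x} {z} {w@(_ ∷ u)} x∈w x≤w z∈w w≤z Lw≡z
  rewrite pitf-suc (length u) w | maxL-≡ z∈w w≤z | Lw≡z | ≡ᵇ-refl z = minL-≡ x∈w x≤w

length-block : ∀ v (x : ℕ) v′ → length (v ++ x ∷ v′) ≡ suc (length v + length v′)
length-block v x v′ = trans (length-++ v) (+-suc (length v) (length v′))

pit-block : ∀ {x z v v′} → All (x <_) v → All (x <_) v′ →
  z ∈ v ++ x ∷ v′ → All (_≤ z) (v ++ x ∷ v′) → L (v ++ x ∷ v′) ≢ z → pit (v ++ x ∷ v′) ≡ pit v′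
pit-block {x} {z} {v} {v′} x<v x<v′ z∈w w≤z L≢z
  rewrite length-block v x v′ | pitf-suc (length v + length v′) (v ++ x ∷ v′)
        | maxL-≡ z∈w w≤z | ≡ᵇ-≢ L≢z | splitOn-block x<v x<v′ =
  pitf-fuel _ _ v′ (m≤n+m _ (length v)) ≤-refl

-- Since `z` stands before `x`, its right neighbour is at the latest `x` itself.
grnAux-suffix : ∀ {z} p x {v} → z ∈ v → ∀ u u′ → grnAux z p (v ++ x ∷ u) ≡ grnAux z p (v ++ x ∷ u′)
grnAux-suffix {z} p x {a ∷ v} z∈ u u′ with a ≡ᵇ z in eq
grnAux-suffix {z} p x {a ∷ []}    z∈ u u′ | true = refl
grnAux-suffix {z} p x {a ∷ b ∷ v} z∈ u u′ | true = refl
grnAux-suffix {z} p x {a ∷ v} (here refl) u u′ | false with trans (sym eq) (≡ᵇ-refl z)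
... | ()
grnAux-suffix {z} p x {a ∷ v} (there z∈) u u′ | false = grnAux-suffix a x z∈ u u′

-- The appended letter is a neighbour of `z` only when `z` ends `v`, and then the left neighbour
-- (`p` if `z` also starts `v`) is already at least `x`.
grnAux-∷ʳ : ∀ {z p x v} → z ∈ v → x ≤ p → All (x ≤_) v → grnAux z p (v ∷ʳ x) ≡ grnAux z p v
grnAux-∷ʳ {z} {p} {x} {a ∷ v} z∈ x≤p (x≤a ∷ x≤v) with a ≡ᵇ z in eq
grnAux-∷ʳ {z} {p} {x} {a ∷ []}    z∈ x≤p (x≤a ∷ x≤v) | true =
  trans (m≥n⇒m⊔n≡m x≤p) (sym (⊔-identityʳ p))
grnAux-∷ʳ {z} {p} {x} {a ∷ b ∷ v} z∈ x≤p (x≤a ∷ x≤v) | true = refl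
grnAux-∷ʳ {z} {p} {x} {a ∷ v} (here refl) x≤p (x≤a ∷ x≤v) | false with trans (sym eq) (≡ᵇ-refl z)
... | ()
grnAux-∷ʳ {z} {p} {x} {a ∷ v} (there z∈) x≤p (x≤a ∷ x≤v) | false = grnAux-∷ʳ z∈ x≤a x≤v

grnAux-prefix : ∀ {z} p v {x u} → All (_< z) (v ∷ʳ x) → grnAux z p (v ++ x ∷ u) ≡ grnAux z x u
grnAux-prefix p []      (x<z ∷ []) rewrite ≡ᵇ-≢ (<⇒≢ x<z) = refl
grnAux-prefix p (a ∷ v) (a<z ∷ vx<z) rewrite ≡ᵇ-≢ (<⇒≢ a<z) = grnAux-prefix a v vx<z

grn-∷ʳ : ∀ {x z v} → 2 ≤ length v → All (x <_) v → z ∈ v → All (_≤ z) v → grn (v ∷ʳ x) ≡ grn v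
grn-∷ʳ {x} {z} {v@(a ∷ b ∷ u)} _ (x<a ∷ x<u) z∈v v≤z
  rewrite maxL-≡ z∈v v≤z
        | maxL-≡ {w = v ∷ʳ x} (∈-++⁺ˡ z∈v) (All.++⁺ v≤z (<⇒≤ (<-≤-trans x<a (All.head v≤z)) ∷ []))
  with a ≡ᵇ z in eq | z∈v
... | true  | _         = refl
... | false | there z∈u = grnAux-∷ʳ z∈u (<⇒≤ x<a) (All.map <⇒≤ x<u)
... | false | here refl with trans (sym eq) (≡ᵇ-refl z)
...   | ()
grn-∷ʳ {v = _ ∷ []} (s≤s ())

grn-left : ∀ {x z v v′} → x < z → z ∈ v → All (_≤ z) v → All (_< z) v′ → grn (v ++ x ∷ v′) ≡ grn (v ∷ʳ x)
grn-left {x} {z} {v} {v′} x<z z∈v v≤z v′<z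
  rewrite maxL-≡ {w = v ∷ʳ x} (∈-++⁺ˡ z∈v) (All.++⁺ v≤z (<⇒≤ x<z ∷ []))
        | maxL-≡ {w = v ++ x ∷ v′} (∈-++⁺ˡ z∈v) (All.++⁺ v≤z (<⇒≤ x<z ∷ All.map <⇒≤ v′<z)) =
  grnAux-suffix 0 x z∈v v′ []

-- If `z` opens `v′`, its left neighbour is `x` in the whole word but the default 0 in `v′` alone.
-- Both are below its right neighbour, which exists since `v′` has two letters.
grn-right : ∀ {x z v v′} → 2 ≤ length v′ → All (x <_) v′ → All (_< z) (v ∷ʳ x) → z ∈ v′ → All (_≤ z) v′ →
  grn (v ++ x ∷ v′) ≡ grn v′
grn-right {x} {z} {v} {v′@(a ∷ b ∷ u)} _ (x<a ∷ x<b ∷ x<u) vx<z z∈v′ v′≤z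
  rewrite maxL-≡ z∈v′ v′≤z
        | maxL-≡ {w = v ++ x ∷ v′} (∈-++⁺ʳ v (there z∈v′))
            (All.++⁺ (All.map <⇒≤ (All.++⁻ˡ v vx<z)) (<⇒≤ (All.head (All.++⁻ʳ v vx<z)) ∷ v′≤z))
        | grnAux-prefix 0 v {u = v′} vx<z
  with a ≡ᵇ z
... | true  = m≤n⇒m⊔n≡n (<⇒≤ x<b)
... | false = refl
grn-right {v′ = _ ∷ []} (s≤s ())

-- Weighted sums over the permutations of a word that satisfy a predicate

W : (List ℕ → Bool) → List ℕ → (List ℕ → ℕ) → ℕ
W P S h = Σ[ perms S ] (λ w → ⟦ P w ⟧ * h w)

W-cong : ∀ P S {g h} → (∀ {w} → w ↭ S → g w ≡ h w) → W P S g ≡ W P S h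
W-cong P S eq = Σ-cong-All (perms-↭ S) (λ {w} w↭S → cong (⟦ P w ⟧ *_) (eq w↭S))

W-cong₂ : ∀ P U V {g h : List ℕ → List ℕ → ℕ} → (∀ {v v′} → v ↭ U → v′ ↭ V → g v v′ ≡ h v v′) →
  W P U (λ v → W P V (g v)) ≡ W P U (λ v → W P V (h v))
W-cong₂ P U V eq = W-cong P U (λ v↭U → W-cong P V (eq v↭U))

W-zero : ∀ P S → W P S (const 0) ≡ 0
W-zero P S = trans (Σ-cong (perms S) (λ w → *-zeroʳ ⟦ P w ⟧)) (Σ-zero (perms S))

W-+ : ∀ P S g h → W P S (λ w → g w + h w) ≡ W P S g + W P S h
W-+ P S g h =
  trans (Σ-cong (perms S) (λ w → *-distribˡ-+ ⟦ P w ⟧ (g w) (h w)))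
        (Σ-+ (λ w → ⟦ P w ⟧ * g w) (λ w → ⟦ P w ⟧ * h w) (perms S))

W-*ˡ : ∀ P S c h → W P S (λ w → c * h w) ≡ c * W P S h
W-*ˡ P S c h =
  trans (Σ-cong (perms S) (λ w → *-left-comm ⟦ P w ⟧ c (h w)))
        (Σ-*ˡ c (λ w → ⟦ P w ⟧ * h w) (perms S))

W-* : ∀ P U V g h → W P U (λ v → W P V (λ v′ → g v * h v′)) ≡ W P U g * W P V h
W-* P U V g h = begin
  W P U (λ v → W P V (λ v′ → g v * h v′))
    ≡⟨ W-cong P U (λ {v} _ → trans (W-*ˡ P V (g v) h) (*-comm (g v) (W P V h))) ⟩
  W P U (λ v → W P V h * g v)
    ≡⟨ W-*ˡ P U (W P V h) g ⟩
  W P V h * W P U g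
    ≡⟨ *-comm (W P V h) (W P U g) ⟩
  W P U g * W P V h ∎

W-singleton : ∀ P x h → P [ x ] ≡ true → W P [ x ] h ≡ h [ x ]
W-singleton P x h eq rewrite eq = lemma (h [ x ])
  where
  lemma : ∀ n → n + 0 + 0 ≡ n
  lemma = solve-∀

Wblock : (List ℕ → Bool) → ℕ → (List ℕ → ℕ) → List ℕ → List ℕ → ℕ
Wblock P x h U V = Σ[ perms U ] (λ v → Σ[ perms V ] (λ v′ → ⟦ P (v ++ x ∷ v′) ⟧ * h (v ++ x ∷ v′)))

Wblock-keep : ∀ P x h U V →
  (∀ {v v′} → v ↭ U → v′ ↭ V → P (v ++ x ∷ v′) ≡ P v ∧ P v′) →
  Wblock P x h U V ≡ W P U (λ v → W P V (λ v′ → h (v ++ x ∷ v′)))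
Wblock-keep P x h U V eq = Σ-cong-All (perms-↭ U) λ {v} v↭U → trans
  (Σ-cong-All (perms-↭ V) λ {v′} v′↭V → trans
    (cong (_* h (v ++ x ∷ v′)) (trans (cong ⟦_⟧ (eq v↭U v′↭V)) (⟦⟧-∧ (P v) (P v′))))
    (*-assoc ⟦ P v ⟧ ⟦ P v′ ⟧ (h (v ++ x ∷ v′))))
  (Σ-*ˡ ⟦ P v ⟧ (λ v′ → ⟦ P v′ ⟧ * h (v ++ x ∷ v′)) (perms V))

Wblock-drop : ∀ P x h U V → (∀ {v v′} → v ↭ U → v′ ↭ V → P (v ++ x ∷ v′) ≡ false) → Wblock P x h U V ≡ 0
Wblock-drop P x h U V eq = trans
  (Σ-cong-All (perms-↭ U) λ {v} v↭U → trans
    (Σ-cong-All (perms-↭ V) λ {v′} v′↭V → cong (λ b → ⟦ b ⟧ * h (v ++ x ∷ v′)) (eq v↭U v′↭V))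
    (Σ-zero (perms V)))
  (Σ-zero (perms U))

-- Removing the minimum letter

Inc : List ℕ → Set
Inc = AllPairs _<_

Inc-⊆ : ∀ {U S} → U ⊆ S → Inc S → Inc U
Inc-⊆ []          []         = []
Inc-⊆ (_ ∷ˢ u)    (_ ∷ i)    = Inc-⊆ u i
Inc-⊆ (refl ∷ u)  (p ∷ i)    = All-resp-⊆ u p ∷ Inc-⊆ u i

Inc-last : ∀ S {z} → Inc (S ∷ʳ z) → All (_< z) S
Inc-last []      _       = []
Inc-last (x ∷ S) (p ∷ i) = All.head (All.++⁻ʳ S p) ∷ Inc-last S i

↭-All : ∀ {P : ℕ → Set} {w S} → w ↭ S → All P S → All P w
↭-All w↭S = All-resp-↭ (↭-sym w↭S)

∷ʳ-∈ : ∀ {w} S {z : ℕ} → w ↭ S ∷ʳ z → z ∈ w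
∷ʳ-∈ S w↭ = ∈-resp-↭ (↭-sym w↭) (∈-++⁺ʳ S (here refl))

∷-∈ : ∀ {w S} {y : ℕ} → w ↭ y ∷ S → y ∈ w
∷-∈ w↭ = ∈-resp-↭ (↭-sym w↭) (here refl)

-- The cases are the two sides for the largest letter `z`. On the left it violates the type I
-- condition; on the right the condition reduces to those on the two factors.
W-I-step : ∀ x S z h → Inc (x ∷ S ∷ʳ z) → W isAndreI (x ∷ S ∷ʳ z) h ≡
  Σsplit (λ U V → W isAndreI U (λ v → W isAndreI (V ∷ʳ z) (λ v′ → h (v ++ x ∷ v′)))) S
W-I-step x S z h (x<Sz ∷ inc) = begin
  W isAndreI (x ∷ S ∷ʳ z) h
    ≡⟨ Σ-perms-block x (λ w → ⟦ isAndreI w ⟧ * h w) (S ∷ʳ z) ⟩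
  Σsplit (Wblock isAndreI x h) (S ∷ʳ z)
    ≡⟨ Σsplit-∷ʳ (Wblock isAndreI x h) S z ⟩
  Σsplit (λ U V → Wblock isAndreI x h (U ∷ʳ z) V) S + Σsplit (λ U V → Wblock isAndreI x h U (V ∷ʳ z)) S
    ≡⟨ cong₂ _+_
         (trans (Σsplit-cong-⊆ S λ {U} {V} u v → Wblock-drop isAndreI x h (U ∷ʳ z) V λ p q →
           andreI-drop (↭-All p (x<ᶻ u)) (↭-All q (x< v)) (∷ʳ-∈ U p) (↭-All p (≤z u)) (↭-All q (<z v)))
           (Σsplit-zero S))
         (Σsplit-cong-⊆ S λ {U} {V} u v → Wblock-keep isAndreI x h U (V ∷ʳ z) λ p q →
           andreI-keep (↭-All p (x< u)) (↭-All q (x<ᶻ v)) (∷ʳ-∈ V q)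
             (All.++⁺ (↭-All p (All.map <⇒≤ (<z u))) (↭-All q (≤z v)))) ⟩
  Σsplit (λ U V → W isAndreI U (λ v → W isAndreI (V ∷ʳ z) (λ v′ → h (v ++ x ∷ v′)))) S ∎
  where
  x< : ∀ {U} → U ⊆ S → All (x <_) U
  x< u = All-resp-⊆ u (All.++⁻ˡ S x<Sz)
  x<ᶻ : ∀ {U} → U ⊆ S → All (x <_) (U ∷ʳ z)
  x<ᶻ u = All.++⁺ (x< u) (All.++⁻ʳ S x<Sz)
  <z : ∀ {U} → U ⊆ S → All (_< z) U
  <z u = All-resp-⊆ u (Inc-last S inc)
  ≤z : ∀ {U} → U ⊆ S → All (_≤ z) (U ∷ʳ z)
  ≤z u = All.++⁺ (All.map <⇒≤ (<z u)) (≤-refl ∷ [])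

-- The same argument with the second smallest letter `y`, which heads the list, so that `Σsplit`
-- unfolds at it directly.
W-II-step : ∀ x y S h → Inc (x ∷ y ∷ S) → W isAndreII (x ∷ y ∷ S) h ≡
  Σsplit (λ U V → W isAndreII U (λ v → W isAndreII (y ∷ V) (λ v′ → h (v ++ x ∷ v′)))) S
W-II-step x y S h (x<yS@(x<y ∷ x<S) ∷ (y<S ∷ _)) = begin
  W isAndreII (x ∷ y ∷ S) h
    ≡⟨ Σ-perms-block x (λ w → ⟦ isAndreII w ⟧ * h w) (y ∷ S) ⟩
  Σsplit (λ U V → Wblock isAndreII x h (y ∷ U) V) S + Σsplit (λ U V → Wblock isAndreII x h U (y ∷ V)) S
    ≡⟨ cong₂ _+_
         (trans (Σsplit-cong-⊆ S λ {U} {V} u v → Wblock-drop isAndreII x h (y ∷ U) V λ p q →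
           andreII-drop (↭-All p (x<y ∷ All-resp-⊆ u x<S)) (↭-All q (All-resp-⊆ v x<S)) (∷-∈ p)
             (↭-All p (y≤ u)) (↭-All q (All-resp-⊆ v y<S)))
           (Σsplit-zero S))
         (Σsplit-cong-⊆ S λ {U} {V} u v → Wblock-keep isAndreII x h U (y ∷ V) λ p q →
           andreII-keep (↭-All p (All-resp-⊆ u x<S)) (↭-All q (x<y ∷ All-resp-⊆ v x<S)) (∷-∈ q)
             (All.++⁺ (↭-All p (All.tail (y≤ u))) (↭-All q (y≤ v)))) ⟩
  Σsplit (λ U V → W isAndreII U (λ v → W isAndreII (y ∷ V) (λ v′ → h (v ++ x ∷ v′)))) S ∎
  where
  y≤ : ∀ {U} → U ⊆ S → All (y ≤_) (y ∷ U)
  y≤ u = ≤-refl ∷ All-resp-⊆ u (All.map <⇒≤ y<S)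

-- Recurrences

tI tII : List ℕ → ℕ
tI  S = W isAndreI S (const 1)
tII S = W isAndreII S (const 1)

Inc-∷-⊆ : ∀ {x U S} → U ⊆ S → Inc (x ∷ S) → Inc (x ∷ U)
Inc-∷-⊆ u = Inc-⊆ (refl ∷ u)

Inc-∷ʳ-⊆ : ∀ {z U S} → U ⊆ S → Inc (S ∷ʳ z) → Inc (U ∷ʳ z)
Inc-∷ʳ-⊆ u = Inc-⊆ (++⁺ u ⊆-refl)

Inc-init : ∀ S {z} → Inc (S ∷ʳ z) → Inc S
Inc-init []      _       = []
Inc-init (x ∷ S) (p ∷ i) = All.++⁻ˡ S p ∷ Inc-init S i

tI-max : ∀ x S z → Inc (x ∷ S ∷ʳ z) → tI (x ∷ S ∷ʳ z) ≡ Σsplit (λ U V → tI U * tI (V ∷ʳ z)) S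
tI-max x S z inc = trans (W-I-step x S z (const 1) inc)
  (Σsplit-cong S λ U V → W-* isAndreI U (V ∷ʳ z) (const 1) (const 1))

-- Brings the type I recurrence, where the largest letter goes right, into the shape of `tII-min`,
-- where the second smallest does.
tI-min : ∀ x y S → Inc (x ∷ y ∷ S) → tI (x ∷ y ∷ S) ≡ Σsplit (λ U V → tI U * tI (y ∷ V)) S
tI-min x y S inc with initLast S
... | []      = tI-max x [] y inc
... | S ∷ʳ′ z = begin
  tI (x ∷ y ∷ S ∷ʳ z)
    ≡⟨ tI-max x (y ∷ S) z inc ⟩
  Σsplit (λ U V → tI (y ∷ U) * tI (V ∷ʳ z)) S + Σsplit (λ U V → tI U * tI (y ∷ V ∷ʳ z)) S
    -- In the terms with `y` on the left and `z` on the right, the two factors trade places.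
    ≡⟨ cong (_+ Σsplit (λ U V → tI U * tI (y ∷ V ∷ʳ z)) S)
         (trans (Σsplit-flip (λ U V → tI (y ∷ U) * tI (V ∷ʳ z)) S)
                (Σsplit-cong S λ U V → *-comm (tI (y ∷ V)) (tI (U ∷ʳ z)))) ⟩
  Σsplit (λ U V → tI (U ∷ʳ z) * tI (y ∷ V)) S + Σsplit (λ U V → tI U * tI (y ∷ V ∷ʳ z)) S
    ≡⟨ sym (Σsplit-∷ʳ (λ U V → tI U * tI (y ∷ V)) S z) ⟩
  Σsplit (λ U V → tI U * tI (y ∷ V)) (S ∷ʳ z) ∎

tII-min : ∀ x y S → Inc (x ∷ y ∷ S) → tII (x ∷ y ∷ S) ≡ Σsplit (λ U V → tII U * tII (y ∷ V)) S
tII-min x y S inc = trans (W-II-step x y S (const 1) inc)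
  (Σsplit-cong S λ U V → W-* isAndreII U (y ∷ V) (const 1) (const 1))

-- Both counts obey the same recurrence and agree on at most one letter. The bound `n` permits
-- induction along arbitrary sublists.
tII≡tI-≤ : ∀ n S → length S ≤ n → Inc S → tII S ≡ tI S
tII≡tI-≤ n       []          _ _ = refl
tII≡tI-≤ n       (x ∷ [])    _ _ = refl
tII≡tI-≤ (suc n) (x ∷ y ∷ S) (s≤s l) inc = begin
  tII (x ∷ y ∷ S)                          ≡⟨ tII-min x y S inc ⟩
  Σsplit (λ U V → tII U * tII (y ∷ V)) S   ≡⟨ Σsplit-cong-⊆ S (λ {U} {V} u v → cong₂ _*_
    (tII≡tI-≤ n U (≤-trans (length-mono-≤ u) (≤-trans (n≤1+n _) l)) (Inc-⊆ u (AllPairs.tail (AllPairs.tail inc))))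
    (tII≡tI-≤ n (y ∷ V) (≤-trans (s≤s (length-mono-≤ v)) l) (Inc-∷-⊆ v (AllPairs.tail inc)))) ⟩
  Σsplit (λ U V → tI U * tI (y ∷ V)) S     ≡⟨ sym (tI-min x y S inc) ⟩
  tI (x ∷ y ∷ S) ∎

tII≡tI : ∀ S → Inc S → tII S ≡ tI S
tII≡tI S = tII≡tI-≤ (length S) S ≤-refl

-- A type I permutation ends with its largest letter, since `z` always goes to the right factor. The
-- weight takes the last letter as a separate argument so that the induction hypothesis applies
-- inside the surrounding word.
W-I-L : ∀ n S z (φ : ℕ → List ℕ → ℕ) → length S ≤ n → Inc (S ∷ʳ z) →
  W isAndreI (S ∷ʳ z) (λ w → φ (L w) w) ≡ W isAndreI (S ∷ʳ z) (φ z)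
W-I-L n       []      z φ _ _ = refl
W-I-L (suc n) (x ∷ S) z φ (s≤s l) inc = begin
  W isAndreI (x ∷ S ∷ʳ z) (λ w → φ (L w) w)
    ≡⟨ W-I-step x S z _ inc ⟩
  Σsplit (λ U V → W isAndreI U (λ v → W isAndreI (V ∷ʳ z) (λ v′ → φ (L (v ++ x ∷ v′)) (v ++ x ∷ v′)))) S
    ≡⟨ Σsplit-cong-⊆ S (λ {U} {V} u v → W-cong isAndreI U λ {w} _ → trans
         (W-cong isAndreI (V ∷ʳ z) λ {w′} q → cong (λ c → φ c (w ++ x ∷ w′)) (L-block w (∷ʳ-∈ V q)))
         (W-I-L n V z (λ c w′ → φ c (w ++ x ∷ w′)) (≤-trans (length-mono-≤ v) l) (Inc-∷ʳ-⊆ v (AllPairs.tail inc)))) ⟩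
  Σsplit (λ U V → W isAndreI U (λ v → W isAndreI (V ∷ʳ z) (λ v′ → φ z (v ++ x ∷ v′)))) S
    ≡⟨ sym (W-I-step x S z _ inc) ⟩
  W isAndreI (x ∷ S ∷ʳ z) (φ z) ∎

-- In terms of increasing binary trees, M ρ x V z is the sum of ρ (parent of z) over the
-- trees on x, V, z whose root x has a single child, and B₀ ρ x V z below the same sum over
-- the trees in which the branch of smallest children ends at z; G ρ x V z collects the
-- parents of z when z lies in the left factor of v x v′.
M : (ℕ → ℕ) → ℕ → List ℕ → ℕ → ℕ
M ρ x V z = W isAndreI (V ∷ʳ z) (λ v → ρ (NL (x ∷ v)))

M-[] : ∀ ρ x z → M ρ x [] z ≡ ρ x
M-[] ρ x z = W-singleton isAndreI z (λ v → ρ (NL (x ∷ v))) refl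

-- The right factor at the minimum `y` contains `z`, so the next-to-last letter is read from
-- `y ∷ v′`; `x` and the left factor drop out.
M-∷ : ∀ ρ x y V z → Inc (y ∷ V ∷ʳ z) → M ρ x (y ∷ V) z ≡ Σsplit (λ U V′ → tI U * M ρ y V′ z) V
M-∷ ρ x y V z inc = trans (W-I-step y V z _ inc) (Σsplit-cong V λ U V′ → trans
  (W-cong₂ isAndreI U (V′ ∷ʳ z) λ {v} {v′} p q →
    trans (cong ρ (NL-block (x ∷ v) (∷ʳ-∈ V′ q))) (sym (*-identityˡ _)))
  (W-* isAndreI U (V′ ∷ʳ z) (const 1) (λ v′ → ρ (NL (y ∷ v′)))))

-- The initial value and the recurrence determine `M`; this identifies `B₀` and `G` with it.
M-unique : ∀ ρ (N : ℕ → List ℕ → ℕ → ℕ) → (∀ x z → x < z → N x [] z ≡ ρ x) →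
  (∀ x y V z → Inc (x ∷ y ∷ V ∷ʳ z) → N x (y ∷ V) z ≡ Σsplit (λ U V′ → tI U * N y V′ z) V) →
  ∀ n x V z → length V ≤ n → Inc (x ∷ V ∷ʳ z) → N x V z ≡ M ρ x V z
M-unique ρ N N-[] N-∷ n x [] z _ ((x<z ∷ []) ∷ _) = trans (N-[] x z x<z) (sym (M-[] ρ x z))
M-unique ρ N N-[] N-∷ (suc n) x (y ∷ V) z (s≤s l) inc = begin
  N x (y ∷ V) z
    ≡⟨ N-∷ x y V z inc ⟩
  Σsplit (λ U V′ → tI U * N y V′ z) V
    ≡⟨ Σsplit-cong-⊆ V (λ {U} {V′} u v → cong (tI U *_) (M-unique ρ N N-[] N-∷ n y V′ z
         (≤-trans (length-mono-≤ v) l) (Inc-∷-⊆ (++⁺ v ⊆-refl) (AllPairs.tail inc)))) ⟩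
  Σsplit (λ U V′ → tI U * M ρ y V′ z) V
    ≡⟨ sym (M-∷ ρ x y V z (AllPairs.tail inc)) ⟩
  M ρ x (y ∷ V) z ∎

-- The greater neighbour of the largest letter in type II permutations

2≤-↭ : ∀ S {x z : ℕ} {w} → w ↭ x ∷ S ∷ʳ z → 2 ≤ length w
2≤-↭ []      w↭ rewrite ↭-length w↭ = s≤s (s≤s z≤n)
2≤-↭ (_ ∷ _) w↭ rewrite ↭-length w↭ = s≤s (s≤s z≤n)

module Letters (x y : ℕ) (S : List ℕ) (z : ℕ) (inc : Inc (x ∷ y ∷ S ∷ʳ z)) where

  x<y : x < y
  x<y = All.head (AllPairs.head inc)

  x<z : x < z
  x<z = All.head (Inc-last (x ∷ y ∷ S) inc)

  y<z : y < z
  y<z = All.head (Inc-last (y ∷ S) (AllPairs.tail inc))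

  x<S : All (x <_) S
  x<S = All.++⁻ˡ S (All.tail (AllPairs.head inc))

  S<z : All (_< z) S
  S<z = Inc-last S (AllPairs.tail (AllPairs.tail inc))

  module Sub {U} (u : U ⊆ S) where

    x<U : All (x <_) U
    x<U = All-resp-⊆ u x<S

    U<z : All (_< z) U
    U<z = All-resp-⊆ u S<z

    x<yU : All (x <_) (y ∷ U)
    x<yU = x<y ∷ x<U

    yU<z : All (_< z) (y ∷ U)
    yU<z = y<z ∷ U<z

    x<Uz : All (x <_) (U ∷ʳ z)
    x<Uz = All.++⁺ x<U (x<z ∷ [])

    x<yUz : All (x <_) (y ∷ U ∷ʳ z)
    x<yUz = x<y ∷ x<Uz

    Uz≤z : All (_≤ z) (U ∷ʳ z)
    Uz≤z = All.++⁺ (All.map <⇒≤ U<z) (≤-refl ∷ [])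

    yUz≤z : All (_≤ z) (y ∷ U ∷ʳ z)
    yUz≤z = <⇒≤ y<z ∷ Uz≤z

    U≤z : All (_≤ z) U
    U≤z = All.map <⇒≤ U<z

grn-swap : ∀ {x z} → x < z → grn (x ∷ z ∷ []) ≡ x
grn-swap {x} {z} x<z
  rewrite maxL-≡ {z} {x ∷ z ∷ []} (there (here refl)) (<⇒≤ x<z ∷ ≤-refl ∷ [])
        | ≡ᵇ-≢ (<⇒≢ x<z) | ≡ᵇ-refl z = ⊔-identityʳ x

grn-∷ : ∀ {x z} → x < z → grn (z ∷ x ∷ []) ≡ x
grn-∷ {x} {z} x<z
  rewrite maxL-≡ {z} {z ∷ x ∷ []} (here refl) (≤-refl ∷ <⇒≤ x<z ∷ []) | ≡ᵇ-refl z = refl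

W-II-pair : ∀ x z h → x < z → W isAndreII (x ∷ z ∷ []) h ≡ h (x ∷ z ∷ [])
W-II-pair x z h x<z = begin
  W isAndreII (x ∷ z ∷ []) h
    ≡⟨ W-II-step x z [] h ((x<z ∷ []) ∷ [] ∷ []) ⟩
  W isAndreII [] (λ v → W isAndreII [ z ] (λ v′ → h (v ++ x ∷ v′)))
    ≡⟨ lemma (W isAndreII [ z ] (λ v′ → h (x ∷ v′))) ⟩
  W isAndreII [ z ] (λ v′ → h (x ∷ v′))
    ≡⟨ W-singleton isAndreII z (λ v′ → h (x ∷ v′)) refl ⟩
  h (x ∷ z ∷ []) ∎
  where
  lemma : ∀ n → n + 0 + 0 ≡ n
  lemma = solve-∀

B₀ : (ℕ → ℕ) → ℕ → List ℕ → ℕ → ℕ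
B₀ ρ x V z = W isAndreII (x ∷ V ∷ʳ z) (λ w → ⟦ L w ≡ᵇ z ⟧ * ρ (grn w))

W-II-step-∷ʳ : ∀ x y S z h → Inc (x ∷ y ∷ S ∷ʳ z) → W isAndreII (x ∷ y ∷ S ∷ʳ z) h ≡
  Σsplit (λ U V → W isAndreII (U ∷ʳ z) (λ v → W isAndreII (y ∷ V) (λ v′ → h (v ++ x ∷ v′)))) S
  + Σsplit (λ U V → W isAndreII U (λ v → W isAndreII (y ∷ V ∷ʳ z) (λ v′ → h (v ++ x ∷ v′)))) S
W-II-step-∷ʳ x y S z h inc = trans (W-II-step x y (S ∷ʳ z) h inc) (Σsplit-∷ʳ _ S z)

-- With `z` in the left factor the word ends with a letter below `z`, and the indicator vanishes.
-- With `z` in the right factor, last letter and greater neighbour are both read there.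
B₀-∷ : ∀ ρ x y V z → Inc (x ∷ y ∷ V ∷ʳ z) → B₀ ρ x (y ∷ V) z ≡ Σsplit (λ U V′ → tI U * B₀ ρ y V′ z) V
B₀-∷ ρ x y S z inc = trans (W-II-step-∷ʳ x y S z _ inc) (cong₂ _+_
  (trans (Σsplit-cong-⊆ S λ {U} {V} u v → trans
      (W-cong₂ isAndreII (U ∷ʳ z) (y ∷ V) λ {w} {w′} p q → cong (λ b → ⟦ b ⟧ * ρ (grn (w ++ x ∷ w′)))
        (trans (cong (_≡ᵇ z) (L-block w (∷-∈ q)))
               (≡ᵇ-≢ (<⇒≢ (All.lookup (↭-All q (Sub.yU<z v)) (L-∈ (∷-∈ q)))))))
      (trans (W-cong isAndreII (U ∷ʳ z) (λ _ → W-zero isAndreII (y ∷ V))) (W-zero isAndreII (U ∷ʳ z))))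
    (Σsplit-zero S))
  (Σsplit-cong-⊆ S λ {U} {V} u v → begin
    W isAndreII U (λ w → W isAndreII (y ∷ V ∷ʳ z) (λ w′ → ⟦ L (w ++ x ∷ w′) ≡ᵇ z ⟧ * ρ (grn (w ++ x ∷ w′))))
      ≡⟨ W-cong₂ isAndreII U (y ∷ V ∷ʳ z) (λ {w} {w′} p q → trans
           (cong₂ (λ l g → ⟦ l ≡ᵇ z ⟧ * ρ g) (L-block w (∷-∈ q))
             (grn-right (2≤-↭ V q) (↭-All q (Sub.x<yUz v)) (All.++⁺ (↭-All p (Sub.U<z u)) (x<z ∷ []))
               (∷ʳ-∈ (y ∷ V) q) (↭-All q (Sub.yUz≤z v))))
           (sym (*-identityˡ _))) ⟩
    W isAndreII U (λ w → W isAndreII (y ∷ V ∷ʳ z) (λ w′ → 1 * (⟦ L w′ ≡ᵇ z ⟧ * ρ (grn w′))))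
      ≡⟨ W-* isAndreII U (y ∷ V ∷ʳ z) (const 1) _ ⟩
    tII U * B₀ ρ y V z
      ≡⟨ cong (_* B₀ ρ y V z) (tII≡tI U (Inc-⊆ u (Inc-init S (AllPairs.tail (AllPairs.tail inc))))) ⟩
    tI U * B₀ ρ y V z ∎))
  where
  open Letters x y S z inc

B₀-[] : ∀ ρ x z → x < z → B₀ ρ x [] z ≡ ρ x
B₀-[] ρ x z x<z = begin
  B₀ ρ x [] z
    ≡⟨ W-II-pair x z (λ w → ⟦ L w ≡ᵇ z ⟧ * ρ (grn w)) x<z ⟩
  ⟦ z ≡ᵇ z ⟧ * ρ (grn (x ∷ z ∷ []))
    ≡⟨ cong₂ (λ b g → ⟦ b ⟧ * ρ g) (≡ᵇ-refl z) (grn-swap x<z) ⟩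
  1 * ρ x
    ≡⟨ *-identityˡ (ρ x) ⟩
  ρ x ∎

B₀≡M : ∀ ρ x V z → Inc (x ∷ V ∷ʳ z) → B₀ ρ x V z ≡ M ρ x V z
B₀≡M ρ x V z = M-unique ρ (B₀ ρ) (B₀-[] ρ) (B₀-∷ ρ) (length V) x V z ≤-refl

G : (ℕ → ℕ) → ℕ → List ℕ → ℕ → ℕ
G ρ x V z = W isAndreII (V ∷ʳ z) (λ v → ρ (grn (v ∷ʳ x)))

G-[] : ∀ ρ x z → x < z → G ρ x [] z ≡ ρ x
G-[] ρ x z x<z = trans (W-singleton isAndreII z (λ v → ρ (grn (v ∷ʳ x))) refl) (cong ρ (grn-∷ x<z))

G-grn : ∀ ρ x y V z → Inc (x ∷ y ∷ V ∷ʳ z) → G ρ x (y ∷ V) z ≡ W isAndreII (y ∷ V ∷ʳ z) (ρ ∘ grn)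
G-grn ρ x y V z inc = W-cong isAndreII (y ∷ V ∷ʳ z) λ p → cong ρ
  (grn-∷ʳ (2≤-↭ V p) (↭-All p (Sub.x<yUz ⊆-refl)) (∷ʳ-∈ (y ∷ V) p) (↭-All p (Sub.yUz≤z ⊆-refl)))
  where
  open Letters x y V z inc

-- With `z` in the left factor, that factor contributes `G` and the other a count. With `z` in the
-- right factor, `G-grn` turns its sum into `G` as well. The two cases match the two parts that can
-- receive the second smallest letter on the right-hand side.
grn-II : ∀ ρ y S z → Inc (y ∷ S ∷ʳ z) →
  W isAndreII (y ∷ S ∷ʳ z) (ρ ∘ grn) ≡ Σsplit (λ U V → tII U * G ρ y V z) S
grn-II ρ y [] z ((y<z ∷ []) ∷ _) = begin
  W isAndreII (y ∷ z ∷ []) (ρ ∘ grn) ≡⟨ W-II-pair y z (ρ ∘ grn) y<z ⟩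
  ρ (grn (y ∷ z ∷ []))               ≡⟨ cong ρ (grn-swap y<z) ⟩
  ρ y                                ≡⟨ sym (G-[] ρ y z y<z) ⟩
  G ρ y [] z                         ≡⟨ sym (*-identityˡ _) ⟩
  1 * G ρ y [] z ∎
grn-II ρ x (y ∷ S) z inc = trans (W-II-step-∷ʳ x y S z _ inc) (cong₂ _+_
  (trans (Σsplit-cong-⊆ S λ {U} {V} u v → begin
      W isAndreII (U ∷ʳ z) (λ w → W isAndreII (y ∷ V) (λ w′ → ρ (grn (w ++ x ∷ w′))))
        ≡⟨ W-cong₂ isAndreII (U ∷ʳ z) (y ∷ V) (λ {w} {w′} p q → trans
             (cong ρ (grn-left x<z (∷ʳ-∈ U p) (↭-All p (Sub.Uz≤z u)) (↭-All q (Sub.yU<z v))))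
             (sym (*-identityʳ _))) ⟩
      W isAndreII (U ∷ʳ z) (λ w → W isAndreII (y ∷ V) (λ w′ → ρ (grn (w ∷ʳ x)) * 1))
        ≡⟨ W-* isAndreII (U ∷ʳ z) (y ∷ V) (λ w → ρ (grn (w ∷ʳ x))) (const 1) ⟩
      G ρ x U z * tII (y ∷ V)
        ≡⟨ *-comm (G ρ x U z) (tII (y ∷ V)) ⟩
      tII (y ∷ V) * G ρ x U z ∎)
    (Σsplit-flip (λ U V → tII (y ∷ V) * G ρ x U z) S))
  (Σsplit-cong-⊆ S λ {U} {V} u v → begin
    W isAndreII U (λ w → W isAndreII (y ∷ V ∷ʳ z) (λ w′ → ρ (grn (w ++ x ∷ w′))))
      ≡⟨ W-cong₂ isAndreII U (y ∷ V ∷ʳ z) (λ {w} {w′} p q → trans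
           (cong ρ (grn-right (2≤-↭ V q) (↭-All q (Sub.x<yUz v)) (All.++⁺ (↭-All p (Sub.U<z u)) (x<z ∷ []))
             (∷ʳ-∈ (y ∷ V) q) (↭-All q (Sub.yUz≤z v))))
           (sym (*-identityˡ _))) ⟩
    W isAndreII U (λ w → W isAndreII (y ∷ V ∷ʳ z) (λ w′ → 1 * ρ (grn w′)))
      ≡⟨ W-* isAndreII U (y ∷ V ∷ʳ z) (const 1) (ρ ∘ grn) ⟩
    tII U * W isAndreII (y ∷ V ∷ʳ z) (ρ ∘ grn)
      ≡⟨ cong (tII U *_) (sym (G-grn ρ x y V z (Inc-⊆ (refl ∷ refl ∷ ++⁺ v ⊆-refl) inc))) ⟩
    tII U * G ρ x (y ∷ V) z ∎))
  where
  open Letters x y S z inc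

-- By `G-grn` the appended `x` disappears, and `grn-II` then reintroduces `G` with `y` in its place:
-- this is the recurrence of `M`.
G≡M : ∀ ρ x V z → Inc (x ∷ V ∷ʳ z) → G ρ x V z ≡ M ρ x V z
G≡M ρ x V z = M-unique ρ (G ρ) (G-[] ρ)
  (λ x y V z inc → trans (G-grn ρ x y V z inc) (trans (grn-II ρ y V z (AllPairs.tail inc))
    (Σsplit-cong-⊆ V λ {U} {V′} u v → cong (_* G ρ y V′ z)
      (tII≡tI U (Inc-⊆ u (Inc-init V (AllPairs.tail (AllPairs.tail inc))))))))
  (length V) x V z ≤-refl

-- The joint sums of three statistics

module Joint (h : ℕ → ℕ → ℕ) where

  -- At the empty word `Â` has the default value `h 0 0`; `Â⁺` replaces it by 0, because an empty
  -- left factor contributes a term of its own.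
  Â B̂ Â⁺ : List ℕ → ℕ
  Â S = W isAndreI S (λ w → h (F w) (spi w))
  B̂ S = W isAndreII S (λ w → h (pit w) (L w))
  Â⁺ []      = 0
  Â⁺ (x ∷ S) = Â (x ∷ S)

  AI BII : (ℕ → ℕ) → List ℕ → ℕ
  AI  ρ S = W isAndreI S (λ w → h (F w) (spi w) * ρ (NL w))
  BII ρ S = W isAndreII S (λ w → h (pit w) (L w) * ρ (grn w))

  -- The two remainders: words with nonempty left factor for type I, words not ending with `z` for
  -- type II.
  A⁻ B⁻ : (ℕ → ℕ) → ℕ → List ℕ → ℕ → ℕ
  A⁻ ρ x S z = Σsplit (λ U V → Â⁺ U * M ρ x V z) S
  B⁻ ρ x S z = W isAndreII (x ∷ S ∷ʳ z) (λ w → ⟦ not (L w ≡ᵇ z) ⟧ * (h (pit w) (L w) * ρ (grn w)))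

  F-spi-block : ∀ {x y v} v′ → All (x <_) v → y ∈ v →
    h (F (v ++ x ∷ v′)) (spi (v ++ x ∷ v′)) ≡ h (F v) (spi v)
  F-spi-block {v = a ∷ u} v′ (x<a ∷ _) _ = cong (h a) (spiAux-++ a u x<a)

  -- A nonempty left factor determines first letter and spike, and the right factor determines the
  -- next-to-last letter. The indicator `δ` isolates the empty left factor.
  AI-rec : ∀ ρ x S z → Inc (x ∷ S ∷ʳ z) → AI ρ (x ∷ S ∷ʳ z) ≡ h x z * M ρ x S z + A⁻ ρ x S z
  AI-rec ρ x S z inc@(x<Sz ∷ inc′) = begin
    AI ρ (x ∷ S ∷ʳ z)
      ≡⟨ W-I-step x S z _ inc ⟩
    Σsplit (λ U V → W isAndreI U (λ v → W isAndreI (V ∷ʳ z) (λ v′ → g (v ++ x ∷ v′)))) S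
      ≡⟨ Σsplit-cong-⊆ S (λ {U} {V} → term U V) ⟩
    Σsplit (λ U V → δ U * (h x z * M ρ x V z) + Â⁺ U * M ρ x V z) S
      ≡⟨ Σsplit-+ (λ U V → δ U * (h x z * M ρ x V z)) _ S ⟩
    Σsplit (λ U V → δ U * (h x z * M ρ x V z)) S + A⁻ ρ x S z
      ≡⟨ cong (_+ A⁻ ρ x S z) (Σsplit-δ (λ V → h x z * M ρ x V z) S) ⟩
    h x z * M ρ x S z + A⁻ ρ x S z ∎
    where
    g : List ℕ → ℕ
    g w = h (F w) (spi w) * ρ (NL w)
    δ : List ℕ → ℕ
    δ []      = 1
    δ (_ ∷ _) = 0
    Σsplit-δ : ∀ f S → Σsplit (λ U V → δ U * f V) S ≡ f S
    Σsplit-δ f []      = *-identityˡ (f [])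
    Σsplit-δ f (y ∷ S) = cong₂ _+_ (Σsplit-zero S) (Σsplit-δ (f ∘ (y ∷_)) S)
    term : ∀ U V → U ⊆ S → V ⊆ S →
      W isAndreI U (λ v → W isAndreI (V ∷ʳ z) (λ v′ → g (v ++ x ∷ v′)))
        ≡ δ U * (h x z * M ρ x V z) + Â⁺ U * M ρ x V z
    -- The word starts with its minimum `x`, so its spike is its last letter, which is `z` for type
    -- I.
    term [] V _ v = cong (λ n → n + 0 + 0) (begin
      W isAndreI (V ∷ʳ z) (λ v′ → g (x ∷ v′))
        ≡⟨ W-cong isAndreI (V ∷ʳ z) (λ {w} q → cong (λ c → h x c * ρ (NL (x ∷ w)))
             (trans (spi-min x (↭-All q (All-resp-⊆ (++⁺ v ⊆-refl) x<Sz))) (L-block [] (∷ʳ-∈ V q)))) ⟩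
      W isAndreI (V ∷ʳ z) (λ v′ → h x (L v′) * ρ (NL (x ∷ v′)))
        ≡⟨ W-I-L (length V) V z (λ c w → h x c * ρ (NL (x ∷ w))) ≤-refl (Inc-∷ʳ-⊆ v inc′) ⟩
      W isAndreI (V ∷ʳ z) (λ v′ → h x z * ρ (NL (x ∷ v′)))
        ≡⟨ W-*ˡ isAndreI (V ∷ʳ z) (h x z) _ ⟩
      h x z * M ρ x V z ∎)
    term U@(_ ∷ _) V u v = trans
      (W-cong₂ isAndreI U (V ∷ʳ z) λ {w} {w′} p q →
        cong₂ (λ a b → a * ρ b) (F-spi-block w′ (↭-All p (All-resp-⊆ u (All.++⁻ˡ S x<Sz))) (∷-∈ p))
                                (NL-block w (∷ʳ-∈ V q)))
      (W-* isAndreI U (V ∷ʳ z) (λ w → h (F w) (spi w)) (λ w → ρ (NL (x ∷ w))))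

  -- The terms with `y` in the left part form the first sum. In the others `M` is expanded at `y`,
  -- and in the resulting threefold distribution the counted part is taken out first.
  A⁻-∷ : ∀ ρ x y S z → Inc (x ∷ y ∷ S ∷ʳ z) → A⁻ ρ x (y ∷ S) z ≡
    Σsplit (λ U V → Â (y ∷ U) * M ρ x V z) S + Σsplit (λ U V → tI U * A⁻ ρ y V z) S
  A⁻-∷ ρ x y S z inc = cong (Σsplit (λ U V → Â (y ∷ U) * M ρ x V z) S +_) (begin
    Σsplit (λ U V → Â⁺ U * M ρ x (y ∷ V) z) S
      ≡⟨ Σsplit-cong-⊆ S (λ {U} {V} u v → trans
           (cong (Â⁺ U *_) (M-∷ ρ x y V z (Inc-⊆ (refl ∷ ++⁺ v ⊆-refl) (AllPairs.tail inc))))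
           (sym (Σsplit-*ˡ (Â⁺ U) _ V))) ⟩
    Σsplit (λ U R → Σsplit (λ V X → Â⁺ U * (tI V * M ρ y X z)) R) S
      ≡⟨ Σsplit-left-comm (λ U V X → Â⁺ U * (tI V * M ρ y X z)) S ⟩
    Σsplit (λ V R → Σsplit (λ U X → Â⁺ U * (tI V * M ρ y X z)) R) S
      ≡⟨ Σsplit-cong S (λ V R → trans
           (Σsplit-cong R λ U X → *-left-comm (Â⁺ U) (tI V) (M ρ y X z))
           (Σsplit-*ˡ (tI V) _ R)) ⟩
    Σsplit (λ V R → tI V * A⁻ ρ y R z) S ∎)

  -- For a word ending with its maximum `z`, the pit is by definition the minimum `x`.
  BII-rec : ∀ ρ x S z → Inc (x ∷ S ∷ʳ z) → BII ρ (x ∷ S ∷ʳ z) ≡ h x z * B₀ ρ x S z + B⁻ ρ x S z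
  BII-rec ρ x S z inc@(x<Sz ∷ _) = begin
    BII ρ (x ∷ S ∷ʳ z)
      ≡⟨ W-cong isAndreII (x ∷ S ∷ʳ z) term ⟩
    W isAndreII (x ∷ S ∷ʳ z) (λ w → h x z * ends w + misses w)
      ≡⟨ W-+ isAndreII (x ∷ S ∷ʳ z) (λ w → h x z * ends w) misses ⟩
    W isAndreII (x ∷ S ∷ʳ z) (λ w → h x z * ends w) + B⁻ ρ x S z
      ≡⟨ cong (_+ B⁻ ρ x S z) (W-*ˡ isAndreII (x ∷ S ∷ʳ z) (h x z) ends) ⟩
    h x z * B₀ ρ x S z + B⁻ ρ x S z ∎
    where
    ends misses : List ℕ → ℕ
    ends w   = ⟦ L w ≡ᵇ z ⟧ * ρ (grn w)
    misses w = ⟦ not (L w ≡ᵇ z) ⟧ * (h (pit w) (L w) * ρ (grn w))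
    identity₁ : ∀ a b → a * b ≡ a * (1 * b) + 0
    identity₁ = solve-∀
    identity₂ : ∀ a b → b ≡ a * 0 + 1 * b
    identity₂ = solve-∀
    term : ∀ {w} → w ↭ x ∷ S ∷ʳ z → h (pit w) (L w) * ρ (grn w) ≡ h x z * ends w + misses w
    term {w} p with L w ≟ z
    ... | no L≢z rewrite ≡ᵇ-≢ L≢z = identity₂ (h x z) _
    ... | yes L≡z
      rewrite pit-max (∷-∈ p) (↭-All p (≤-refl ∷ All.map <⇒≤ x<Sz)) (∷ʳ-∈ (x ∷ S) p)
                (↭-All p (All.++⁺ (All.map <⇒≤ (Inc-last (x ∷ S) inc)) (≤-refl ∷ []))) L≡z
            | L≡z | ≡ᵇ-refl z = identity₁ (h x z) (ρ (grn w))

  -- With `z` in the left factor the word cannot end with `z`: pit and last letter come from the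
  -- right factor, the greater neighbour from the left one followed by `x`. With `z` in the right
  -- factor everything is read there, including whether it ends with `z`.
  B⁻-∷ : ∀ ρ x y S z → Inc (x ∷ y ∷ S ∷ʳ z) → B⁻ ρ x (y ∷ S) z ≡
    Σsplit (λ U V → B̂ (y ∷ U) * G ρ x V z) S + Σsplit (λ U V → tII U * B⁻ ρ y V z) S
  B⁻-∷ ρ x y S z inc = trans (W-II-step-∷ʳ x y S z _ inc) (cong₂ _+_
    (trans (Σsplit-cong-⊆ S (λ {U} {V} → z-left U V)) (Σsplit-flip (λ U V → B̂ (y ∷ V) * G ρ x U z) S))
    (Σsplit-cong-⊆ S (λ {U} {V} → z-right U V)))
    where
    open Letters x y S z inc
    g : List ℕ → ℕ
    g w = ⟦ not (L w ≡ᵇ z) ⟧ * (h (pit w) (L w) * ρ (grn w))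
    identity : ∀ a b → 1 * (a * b) ≡ b * a
    identity = solve-∀
    z-left : ∀ U V → U ⊆ S → V ⊆ S →
      W isAndreII (U ∷ʳ z) (λ w → W isAndreII (y ∷ V) (λ w′ → g (w ++ x ∷ w′))) ≡ B̂ (y ∷ V) * G ρ x U z
    z-left U V u v = trans (W-cong₂ isAndreII (U ∷ʳ z) (y ∷ V) term) (trans
      (W-* isAndreII (U ∷ʳ z) (y ∷ V) (λ w → ρ (grn (w ∷ʳ x))) (λ w → h (pit w) (L w)))
      (*-comm (G ρ x U z) (B̂ (y ∷ V))))
      where
      L≢z : ∀ {w′} → w′ ↭ y ∷ V → L w′ ≢ z
      L≢z q = <⇒≢ (All.lookup (↭-All q (Sub.yU<z v)) (L-∈ (∷-∈ q)))
      term : ∀ {w w′} → w ↭ U ∷ʳ z → w′ ↭ y ∷ V →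
        g (w ++ x ∷ w′) ≡ ρ (grn (w ∷ʳ x)) * h (pit w′) (L w′)
      term {w} {w′} p q
        rewrite pit-block (↭-All p (Sub.x<Uz u)) (↭-All q (Sub.x<yU v)) (∈-++⁺ˡ {ys = x ∷ w′} (∷ʳ-∈ U p))
                  (All.++⁺ (↭-All p (Sub.Uz≤z u)) (<⇒≤ x<z ∷ ↭-All q (All.map <⇒≤ (Sub.yU<z v))))
                  (λ e → L≢z q (trans (sym (L-block w (∷-∈ q))) e))
              | L-block w {x} (∷-∈ q) | ≡ᵇ-≢ (L≢z q)
              | grn-left x<z (∷ʳ-∈ U p) (↭-All p (Sub.Uz≤z u)) (↭-All q (Sub.yU<z v)) =
        identity (h (pit w′) (L w′)) (ρ (grn (w ∷ʳ x)))
    z-right : ∀ U V → U ⊆ S → V ⊆ S →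
      W isAndreII U (λ w → W isAndreII (y ∷ V ∷ʳ z) (λ w′ → g (w ++ x ∷ w′))) ≡ tII U * B⁻ ρ y V z
    z-right U V u v = trans
      (W-cong₂ isAndreII U (y ∷ V ∷ʳ z) λ p q → trans (term p q) (sym (*-identityˡ _)))
      (W-* isAndreII U (y ∷ V ∷ʳ z) (const 1) g)
      where
      term : ∀ {w w′} → w ↭ U → w′ ↭ y ∷ V ∷ʳ z → g (w ++ x ∷ w′) ≡ g w′
      term {w} {w′} p q
        rewrite L-block w {x} (∷-∈ q)
              | grn-right {v = w} (2≤-↭ V q) (↭-All q (Sub.x<yUz v)) (All.++⁺ (↭-All p (Sub.U<z u)) (x<z ∷ []))
                  (∷ʳ-∈ (y ∷ V) q) (↭-All q (Sub.yUz≤z v))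
        -- If `w′` ends with `z`, both weights vanish, so the pits are compared only where
        -- `pit-block` applies.
        with L w′ ≟ z
      ... | yes L≡z rewrite L≡z | ≡ᵇ-refl z = refl
      ... | no  L≢z
        rewrite pit-block (↭-All p (Sub.x<U u)) (↭-All q (Sub.x<yUz v)) (∈-++⁺ʳ w (there (∷ʳ-∈ (y ∷ V) q)))
                  (All.++⁺ (↭-All p (Sub.U≤z u)) (<⇒≤ x<z ∷ ↭-All q (Sub.yUz≤z v)))
                  (λ e → L≢z (trans (sym (L-block w (∷-∈ q))) e)) = refl

  -- Simultaneous induction with `Â≡B̂`: the remainders need equality of `Â` and `B̂` on shorter
  -- lists, which is the full equality for the constant weight `ρ` equal to 1.
  A⁻≡B⁻ : ∀ n ρ x S z → length S ≤ n → Inc (x ∷ S ∷ʳ z) → A⁻ ρ x S z ≡ B⁻ ρ x S z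
  Â≡B̂   : ∀ n x S → length S ≤ n → Inc (x ∷ S) → Â (x ∷ S) ≡ B̂ (x ∷ S)

  -- The only type II word is `x z`, which ends with `z`, so both remainders are 0.
  A⁻≡B⁻ n ρ x [] z _ ((x<z ∷ []) ∷ _) = sym (trans
    (W-II-pair x z (λ w → ⟦ not (L w ≡ᵇ z) ⟧ * (h (pit w) (L w) * ρ (grn w))) x<z)
    (cong (λ b → ⟦ not b ⟧ * (h (pit (x ∷ z ∷ [])) z * ρ (grn (x ∷ z ∷ [])))) (≡ᵇ-refl z)))
  A⁻≡B⁻ (suc n) ρ x (y ∷ S) z (s≤s l) inc = begin
    A⁻ ρ x (y ∷ S) z
      ≡⟨ A⁻-∷ ρ x y S z inc ⟩
    Σsplit (λ U V → Â (y ∷ U) * M ρ x V z) S + Σsplit (λ U V → tI U * A⁻ ρ y V z) S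
      ≡⟨ cong₂ _+_
           (Σsplit-cong-⊆ S λ {U} {V} u v → cong₂ _*_
             (Â≡B̂ n y U (≤-trans (length-mono-≤ u) l)
               (Inc-∷-⊆ u (Inc-init (y ∷ S) (AllPairs.tail inc))))
             (sym (G≡M ρ x V z (Inc-⊆ (refl ∷ y ∷ˢ ++⁺ v ⊆-refl) inc))))
           (Σsplit-cong-⊆ S λ {U} {V} u v → cong₂ _*_
             (sym (tII≡tI U (Inc-⊆ u (Inc-init S (AllPairs.tail (AllPairs.tail inc))))))
             (A⁻≡B⁻ n ρ y V z (≤-trans (length-mono-≤ v) l) (Inc-⊆ (refl ∷ ++⁺ v ⊆-refl) (AllPairs.tail inc)))) ⟩
    Σsplit (λ U V → B̂ (y ∷ U) * G ρ x V z) S + Σsplit (λ U V → tII U * B⁻ ρ y V z) S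
      ≡⟨ sym (B⁻-∷ ρ x y S z inc) ⟩
    B⁻ ρ x (y ∷ S) z ∎

  AI≡BII-≤ : ∀ n ρ x S z → length S ≤ n → Inc (x ∷ S ∷ʳ z) → AI ρ (x ∷ S ∷ʳ z) ≡ BII ρ (x ∷ S ∷ʳ z)
  AI≡BII-≤ n ρ x S z l inc = begin
    AI ρ (x ∷ S ∷ʳ z)               ≡⟨ AI-rec ρ x S z inc ⟩
    h x z * M ρ x S z + A⁻ ρ x S z  ≡⟨ cong₂ (λ m a → h x z * m + a) (sym (B₀≡M ρ x S z inc)) (A⁻≡B⁻ n ρ x S z l inc) ⟩
    h x z * B₀ ρ x S z + B⁻ ρ x S z ≡⟨ sym (BII-rec ρ x S z inc) ⟩
    BII ρ (x ∷ S ∷ʳ z) ∎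

  Â≡B̂ n x S l inc with initLast S
  -- For a single letter, first letter, spike, pit and last letter coincide.
  ... | [] = cong (λ c → 1 * h c x + 0)
    (sym (pit-max {z = x} (here refl) (≤-refl ∷ []) (here refl) (≤-refl ∷ []) refl))
  ... | S ∷ʳ′ z = begin
    Â (x ∷ S ∷ʳ z)            ≡⟨ W-cong isAndreI (x ∷ S ∷ʳ z) (λ _ → sym (*-identityʳ _)) ⟩
    AI (const 1) (x ∷ S ∷ʳ z) ≡⟨ AI≡BII-≤ n (const 1) x S z
      (≤-trans (≤-trans (m≤m+n _ 1) (≤-reflexive (sym (length-++ S)))) l) inc ⟩
    BII (const 1) (x ∷ S ∷ʳ z) ≡⟨ W-cong isAndreII (x ∷ S ∷ʳ z) (λ _ → *-identityʳ _) ⟩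
    B̂ (x ∷ S ∷ʳ z) ∎

  AI≡BII : ∀ ρ S → 2 ≤ length S → Inc S → AI ρ S ≡ BII ρ S
  AI≡BII ρ []      () _
  AI≡BII ρ (x ∷ S) l inc with initLast S | l
  ... | []      | s≤s ()
  ... | S ∷ʳ′ z | _      = AI≡BII-≤ (length S) ρ x S z ≤-refl inc

-- From weighted sums to counts

countB-Σ : (P : A → Bool) (xs : List A) → countB P xs ≡ Σ[ xs ] (λ x → ⟦ P x ⟧)
countB-Σ P []       = refl
countB-Σ P (x ∷ xs) with P x
... | true  = cong suc (countB-Σ P xs)
... | false = countB-Σ P xs

-- The tests become a product of indicators, bracketed so that the first two form the weight `h` and
-- the third forms `ρ`.
countB-W : ∀ (P : List ℕ → Bool) (f g k : List ℕ → Bool) S →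
  countB (λ w → P w ∧ f w ∧ g w ∧ k w) (perms S) ≡ W P S (λ w → ⟦ f w ⟧ * ⟦ g w ⟧ * ⟦ k w ⟧)
countB-W P f g k S = trans (countB-Σ _ (perms S)) (Σ-cong (perms S) λ w → begin
  ⟦ P w ∧ f w ∧ g w ∧ k w ⟧           ≡⟨ ⟦⟧-∧ (P w) (f w ∧ g w ∧ k w) ⟩
  ⟦ P w ⟧ * ⟦ f w ∧ g w ∧ k w ⟧       ≡⟨ cong (⟦ P w ⟧ *_) (trans (⟦⟧-∧ (f w) (g w ∧ k w))
    (trans (cong (⟦ f w ⟧ *_) (⟦⟧-∧ (g w) (k w))) (sym (*-assoc ⟦ f w ⟧ ⟦ g w ⟧ ⟦ k w ⟧)))) ⟩
  ⟦ P w ⟧ * (⟦ f w ⟧ * ⟦ g w ⟧ * ⟦ k w ⟧) ∎)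

range1-Inc : ∀ n → Inc (range1 n)
range1-Inc n = AllPairs.map⁺ (AllPairs.applyUpTo⁺₁ (λ i → i) n (λ i<j _ → s≤s i<j))

range1-length : ∀ n → length (range1 n) ≡ n
range1-length n = trans (length-map suc (upTo n)) (length-upTo n)

theorem3p1 : (n : ℕ) → 2 ≤ n → (p q r : ℕ) →
    countB (λ w → isAndreI w ∧ (F w ≡ᵇ p) ∧ (spi w ≡ᵇ q) ∧ (NL w ≡ᵇ r)) (perms (range1 n))
    ≡ countB (λ w → isAndreII w ∧ (pit w ≡ᵇ p) ∧ (L w ≡ᵇ q) ∧ (grn w ≡ᵇ r)) (perms (range1 n))
theorem3p1 n 2≤n p q r = begin
  countB (λ w → isAndreI w ∧ (F w ≡ᵇ p) ∧ (spi w ≡ᵇ q) ∧ (NL w ≡ᵇ r)) (perms (range1 n))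
    ≡⟨ countB-W isAndreI (λ w → F w ≡ᵇ p) (λ w → spi w ≡ᵇ q) (λ w → NL w ≡ᵇ r) (range1 n) ⟩
  AI (λ c → ⟦ c ≡ᵇ r ⟧) (range1 n)
    ≡⟨ AI≡BII (λ c → ⟦ c ≡ᵇ r ⟧) (range1 n) (subst (2 ≤_) (sym (range1-length n)) 2≤n) (range1-Inc n) ⟩
  BII (λ c → ⟦ c ≡ᵇ r ⟧) (range1 n)
    ≡⟨ sym (countB-W isAndreII (λ w → pit w ≡ᵇ p) (λ w → L w ≡ᵇ q) (λ w → grn w ≡ᵇ r) (range1 n)) ⟩
  countB (λ w → isAndreII w ∧ (pit w ≡ᵇ p) ∧ (L w ≡ᵇ q) ∧ (grn w ≡ᵇ r)) (perms (range1 n)) ∎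
  where
  -- As `h` serves the indicator of the pair `(p, q)`; the indicator of `r` is the weight `ρ` above.
  open Joint (λ a b → ⟦ a ≡ᵇ p ⟧ * ⟦ b ≡ᵇ q ⟧)
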